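{- Let $q$ be a prime power, $n\ge4$, $1\le s\le n-1$ with $\gcd(s,n)=1$, and $\delta\in\mathbb{F}_{q^n}$ with $\mathrm{N}_{q^n/q}(\delta)\notin\{0,1\}$. Then the linear set $L^{2,n}_{s,\delta}$ is not of pseudoregulus type. Moreover, for all $\delta,\rho\in\mathbb{F}_{q^8}$ with $\mathrm{N}_{q^8/q}(\delta),\mathrm{N}_{q^8/q}(\rho)\notin\{0,1\}$, the linear sets $L^{2,8}_{1,\delta}$ and $L^{2,8}_{3,\rho}$ are not $\mathrm{P\Gamma L}(2,q^8)$-equivalent.
   Context: For an $\mathbb{F}_q$-subspace $U$ of $\mathbb{F}_{q^n}^2$, the $\mathbb{F}_q$-linear set $L_U=\{\langle u\rangle_{\mathbb{F}_{q^n}} : u\in U\setminus\{0\}\}\subseteq \mathrm{PG}(1,q^n)$. $\mathrm{N}_{q^n/q}(\alpha)=\alpha^{1+q+\dots+q^{n-1}}$. $L^{2,n}_{s,\delta}$ is the linear set defined by $U^{2,n}_{s,\delta}=\{(x,\delta x^{q^s}+x^{q^{n-s}}) : x\in\mathbb{F}_{q^n}\}$. $L^{1,n}_{1}$ is the linear set defined by $U^{1,n}_1=\{(x,x^{q}) : x\in\mathbb{F}_{q^n}\}$. A linear set of $\mathrm{PG}(1,q^n)$ is of pseudoregulus type if it is $\mathrm{P\Gamma L}(2,q^n)$-equivalent to $L^{1,n}_1$. Two linear sets $L,L'$ are $\mathrm{P\Gamma L}(2,q^n)$-equivalent if $L^\phi=L'$ for some $\phi\in\mathrm{P\Gamma L}(2,q^n)$.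 -}

module Defs where

open import Level using (0ℓ)
open import Data.Nat as ℕ using (ℕ; zero; suc)
open import Data.Nat.Primality using (Prime)
open import Data.Fin using (Fin)
open import Data.Product using (Σ; ∃; ∃-syntax; _×_; _,_)
open import Relation.Binary.PropositionalEquality using (_≡_; _≢_)
open import Relation.Nullary using (¬_)
open import Function.Bundles using (_↔_; _⇔_)
open import Function.Definitions using (Bijective)
open import Algebra.Structures using (IsCommutativeRing)

IsPrimePower : ℕ → Set
IsPrimePower q = ∃[ p ] ∃[ k ] (Prime p × q ≡ p ℕ.^ suc k)

normExp : ℕ → ℕ → ℕ
normExp q zero    = 0
normExp q (suc n) = q ℕ.^ n ℕ.+ normExp q n

record FiniteField (N : ℕ) : Set₁ where
  infixl 7 _*_
  infixl 6 _+_
  field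
    K      : Set
    _+_    : K → K → K
    _*_    : K → K → K
    -_     : K → K
    0#     : K
    1#     : K
    isCommutativeRing : IsCommutativeRing _≡_ _+_ _*_ -_ 0# 1#
    0≢1    : 0# ≢ 1#
    inverse : ∀ x → x ≢ 0# → ∃[ y ] (x * y ≡ 1#)
    card   : K ↔ Fin N

  _^_ : K → ℕ → K
  x ^ zero  = 1#
  x ^ suc m = x * (x ^ m)

  Vec2 : Set
  Vec2 = K × K

  NonZero2 : Vec2 → Set
  NonZero2 (a , b) = ¬ (a ≡ 0# × b ≡ 0#)

  -- same point of PG(1, K): proportional nonzero vectors
  _∼_ : Vec2 → Vec2 → Set
  (a , b) ∼ (c , d) = ∃[ λ' ] (λ' ≢ 0# × (c ≡ λ' * a × d ≡ λ' * b))

  Norm : (q n : ℕ) → K → K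
  Norm q n α = α ^ normExp q n

  -- The linear set L_U for U = {(x, f x) : x ∈ K}, as a predicate on
  -- nonzero vectors (a point ⟨(a,b)⟩ lies in L_U iff it is ⟨u⟩ for some
  -- nonzero u ∈ U).  Nonzero elements of U are exactly those with x ≠ 0
  -- for the (additive) maps f considered here.
  LinSet : (K → K) → Vec2 → Set
  LinSet f v = ∃[ x ] (x ≢ 0# × (v ∼ (x , f x)) ) 

  f2 : (q n s : ℕ) → K → K → K
  f2 q n s δ x = δ * (x ^ (q ℕ.^ s)) + (x ^ (q ℕ.^ (n ℕ.∸ s)))

  L2 : (q n s : ℕ) → K → Vec2 → Set
  L2 q n s δ = LinSet (f2 q n s δ)

  L1 : (q : ℕ) → Vec2 → Set
  L1 q = LinSet (λ x → x ^ q)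

  record FieldAut : Set where
    field
      σ       : K → K
      bij     : Bijective _≡_ _≡_ σ
      pres-+  : ∀ x y → σ (x + y) ≡ σ x + σ y
      pres-*  : ∀ x y → σ (x * y) ≡ σ x * σ y
      pres-1  : σ 1# ≡ 1#

  record GammaL2 : Set where
    field
      aut : FieldAut
      a b c d : K
      det≢0 : (a * d + - (b * c)) ≢ 0#

  act : GammaL2 → Vec2 → Vec2
  act g (x , y) = (a * σ x + b * σ y , c * σ x + d * σ y)
    where open GammaL2 g
          open FieldAut aut

  -- L^φ = L' as sets of points of PG(1,K), where φ ∈ PΓL(2,K) is induced by g
  ImageEq : GammaL2 → (Vec2 → Set) → (Vec2 → Set) → Set
  ImageEq g L L' = ∀ w → NonZero2 w →
    (L' w ⇔ (∃[ v ] (NonZero2 v × L v × (act g v ∼ w))))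

  PΓLEquivalent : (Vec2 → Set) → (Vec2 → Set) → Set
  PΓLEquivalent L L' = ∃[ g ] ImageEq g L L'

  PseudoregulusType : (q : ℕ) → (Vec2 → Set) → Set
  PseudoregulusType q L = PΓLEquivalent (L1 q) L

{-# OPTIONS --safe #-}
-- Writing L_f for {⟨(x, f x)⟩}, an additive f takes each slope m of L_f on −1 many nonzero x modulo the
-- characteristic, so ∑ φ(f x / x) over x ≠ 0 depends only on L_f.  For a q-polynomial f = ∑ aᵢ x^(q^i),
-- taking φ(m) = m and φ(m) = m^(1 + q^k) shows that L_f determines a₀ and, when a₀ = 0, the products
-- a_k a_{n−k}^(q^k).  (Distinct exponents need q > 2; for q = 2 every norm is 0 or 1.)
-- If an element of ΓL₂ maps L_f to L_h, then L_h = L_G for a q-polynomial G with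
-- G ∘ (a X + b f^σ) = c X + d f^σ, and comparing coefficients in this identity gives linear recurrences
-- for the coefficients of G which contradict the products read off from h.
module Submission where

open import Defs
open import Level using (0ℓ)
open import Algebra.Bundles using (CommutativeRing; CommutativeMonoid)
import Algebra.Properties.CommutativeMonoid.Sum as MonoidSum
import Algebra.Properties.CommutativeSemiring.Binomial as BinomialTheorem
import Algebra.Properties.CommutativeSemiring.Exp as Exponentiation
import Algebra.Properties.Ring as RingProperties
import Algebra.Properties.Semiring.Mult as Multiples
import Algebra.Properties.Semiring.Sum as SemiringSum
import Algebra.Solver.Ring.NaturalCoefficients.Default as SemiringSolver
open import Data.Empty using (⊥)
open import Data.Fin as Fin using (Fin; toℕ; fromℕ<)
import Data.Fin.Permutation as Perm
import Data.Fin.Properties as Fin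
open import Data.Nat as ℕ using (ℕ; zero; suc; _≤_; _<_; _∸_; z≤n; s≤s; NonZero; _!)
open import Data.Nat.Combinatorics using (_C_; nCk≡n!/k![n-k]!; nCn≡1; k![n∸k]!∣n!)
open import Data.Nat.Divisibility using (_∣_; divides; ∣1⇒≡1; ∣⇒≤; m∣m*n; ∣m+n∣m⇒∣n; ∣m∣n⇒∣m+n; ∣-refl)
open import Data.Nat.DivMod using (_%_; _mod_; m/n*n≡m; m<n⇒m%n≡m; [m+n]%n≡m%n)
open import Data.Nat.GCD using (gcd; gcd-greatest)
open import Data.Nat.Primality using (Prime; euclidsLemma; prime⇒nonTrivial; prime⇒nonZero; ¬prime[0])
import Data.Nat.Properties as ℕ
open import Data.Product using (∃; ∃-syntax; _×_; _,_; proj₁; proj₂)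
open import Data.Sum using (_⊎_; inj₁; inj₂; [_,_]′)
open import Data.Vec as Vec using (Vec; []; _∷_)
open import Function using (_∘_; id; case_of_)
open import Function.Bundles using (Inverse; Equivalence; mk↔ₛ′)
open import Relation.Binary.Definitions using (DecidableEquality; tri<; tri≈; tri>)
open import Relation.Binary.PropositionalEquality
open import Relation.Nullary using (¬_; Dec; yes; no; contradiction)
open import Relation.Nullary.Decidable using (_×-dec_; ¬?; map′; from-yes)

-- Put P = a X + b f^σ and Q = c X + d f^σ, so that the points ⟨(x, f x)⟩ are sent to ⟨(P y, Q y)⟩
-- with y = σ x. No point of L_h has first coordinate 0, hence P has no nonzero root, is a
-- bijection, and G is Q ∘ P⁻¹. The obstacle is that this inverse must again be a q-polynomial;
-- counting q-polynomials avoids computing it. Equal linear sets may come from different subspaces,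
-- so G need not be h: only the constant slope coefficient and the products G_k G_{n-k}^(q^k) are
-- shared. For h supported on {s, n-s} these products vanish at every k in {1, ..., n-1} outside
-- that pair and are nonzero on it. So G is nonzero at s and n-s and has a zero in every other pair
-- {k, n-k}, and it is this pattern of zeros, not the values, that the recurrences cannot
-- accommodate.

module _ (M : CommutativeMonoid 0ℓ 0ℓ) where
  open CommutativeMonoid M using (Carrier; _≈_; ε; ∙-congˡ; identityʳ) renaming (trans to ≈-trans)
  open MonoidSum M using (sum; sum-remove; sum-cong-≋; sum-replicate-zero)

  sum-single : ∀ {m} (f : Fin m → Carrier) k → (∀ i → i ≢ k → f i ≈ ε) → sum f ≈ f k
  sum-single {suc m} f k f≈ε = ≈-trans (sum-remove f) (≈-trans (∙-congˡ rest) (identityʳ (f k)))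
    where
    rest = ≈-trans (sum-cong-≋ (λ i → f≈ε (Fin.punchIn k i) (Fin.punchInᵢ≢i k i))) (sum-replicate-zero m)

-- Binomial coefficients modulo a prime, and the pigeonhole principle

prime∣n!⇒≤ : ∀ {p} → Prime p → ∀ n → p ∣ n ! → p ≤ n
prime∣n!⇒≤ pr zero    p∣1 = contradiction (∣1⇒≡1 p∣1) (ℕ.nonTrivial⇒≢1 {{prime⇒nonTrivial pr}})
prime∣n!⇒≤ pr (suc n) p∣ with euclidsLemma (suc n) (n !) pr p∣
... | inj₁ p∣1+n = ∣⇒≤ p∣1+n
... | inj₂ p∣n!  = ℕ.m≤n⇒m≤1+n (prime∣n!⇒≤ pr n p∣n!)

-- The product of `p C k` with `k !` and `(p ∸ k) !` is `p !`, and `p` divides neither factorial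
-- because both arguments are below `p`.
prime∣C : ∀ {p} → Prime p → ∀ k → 0 < k → k < p → p ∣ p C k
prime∣C {p@(suc p-1)} pr k 0<k k<p = case euclidsLemma (p C k) (k ! ℕ.* (p ∸ k) !) pr p∣ of λ where
    (inj₁ p∣C) → p∣C
    (inj₂ p∣k!m!) → case euclidsLemma (k !) ((p ∸ k) !) pr p∣k!m! of λ where
      (inj₁ p∣k!) → contradiction (prime∣n!⇒≤ pr k p∣k!) (ℕ.<⇒≱ k<p)
      (inj₂ p∣m!) → contradiction (prime∣n!⇒≤ pr (p ∸ k) p∣m!) (ℕ.<⇒≱ (ℕ.∸-monoʳ-< 0<k (ℕ.<⇒≤ k<p)))
  where
  instance _ = k ℕ.!* (p ∸ k) !≢0
  C*≡p! : (p C k) ℕ.* (k ! ℕ.* (p ∸ k) !) ≡ p !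
  C*≡p! = trans (cong (ℕ._* (k ! ℕ.* (p ∸ k) !)) (nCk≡n!/k![n-k]! (ℕ.<⇒≤ k<p)))
                (m/n*n≡m (k![n∸k]!∣n! (ℕ.<⇒≤ k<p)))
  p∣ : p ∣ (p C k) ℕ.* (k ! ℕ.* (p ∸ k) !)
  p∣ = subst (p ∣_) (sym C*≡p!) (m∣m*n (p-1 !))

-- If `j` were missed, punching it out of the codomain would inject `Fin (suc m)` into `Fin m`.
injective⇒surjective : ∀ {m} (f : Fin m → Fin m) → (∀ {i j} → f i ≡ f j → i ≡ j) → ∀ j → ∃[ i ] f i ≡ j
injective⇒surjective {m} f inj j with Fin.any? (λ i → f i Fin.≟ j)
... | yes hit = hit
injective⇒surjective {suc m} f inj j | no miss =
  contradiction (Fin.injective⇒≤ {f = λ i → Fin.punchOut (j≢f i)}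
    (λ {x} {y} eq → inj (Fin.punchOut-injective (j≢f x) (j≢f y) eq))) ℕ.1+n≰n
  where
  j≢f : ∀ i → j ≢ f i
  j≢f i j≡fi = miss (i , sym j≡fi)

-- Arithmetic and sums in a finite field

module FieldTheory {N : ℕ} (F : FiniteField N) where
  open FiniteField F

  ring : CommutativeRing 0ℓ 0ℓ
  ring = record { isCommutativeRing = isCommutativeRing }

  open CommutativeRing ring public
    using ( +-identityˡ; +-identityʳ; +-assoc; +-comm; -‿inverseˡ; -‿inverseʳ
          ; *-identityˡ; *-identityʳ; *-assoc; *-comm; distribˡ; distribʳ; zeroˡ; zeroʳ
          ; semiring; commutativeSemiring; *-commutativeMonoid; +-commutativeMonoid)
  open RingProperties (CommutativeRing.ring ring) public
    using (+-cancelʳ; +-cancelˡ)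
  open SemiringSum semiring public
    using (sum; sum-cong-≗; sum-permute; sum-replicate; sum-replicate-zero; ∑-comm; ∑-distrib-+; *-distribˡ-sum;
        *-distribʳ-sum)
  module Π = MonoidSum *-commutativeMonoid
  module E = Exponentiation commutativeSemiring
  open Multiples semiring public using () renaming (_×_ to _·_)
  module M = Multiples semiring

  open SemiringSolver commutativeSemiring public using (solve; _:=_; _:+_; _:*_)

  open ≡-Reasoning

  open Inverse card public using (to; from; strictlyInverseˡ; strictlyInverseʳ)

  to-injective : ∀ {x y} → to x ≡ to y → x ≡ y
  to-injective eq = trans (sym (strictlyInverseʳ _)) (trans (cong from eq) (strictlyInverseʳ _))

  from-injective : ∀ {i j} → from i ≡ from j → i ≡ j
  from-injective eq = trans (sym (strictlyInverseˡ _)) (trans (cong to eq) (strictlyInverseˡ _))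

  infix 4 _≟_
  _≟_ : DecidableEquality K
  x ≟ y = map′ to-injective (cong to) (to x Fin.≟ to y)

  any? : ∀ {P : K → Set} → (∀ x → Dec (P x)) → Dec (∃ P)
  any? {P} P? = map′ (λ (i , p) → from i , p) (λ (x , p) → to x , subst P (sym (strictlyInverseʳ x)) p)
                     (Fin.any? (λ i → P? (from i)))

  x≡0⇒x*y≡0 : ∀ {x} → x ≡ 0# → ∀ y → x * y ≡ 0#
  x≡0⇒x*y≡0 refl y = zeroˡ y

  y≡0⇒x*y≡0 : ∀ {y} → y ≡ 0# → ∀ x → x * y ≡ 0#
  y≡0⇒x*y≡0 refl x = zeroʳ x

  -- Totalised by `inv 0# ≡ 0#`: the ratio f x / x becomes 0 at x = 0, so sums over nonzero x can be
  -- taken over all of `K`.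
  inv : K → K
  inv x with x ≟ 0#
  ... | yes _   = 0#
  ... | no  x≢0 = proj₁ (inverse x x≢0)

  inv-0 : inv 0# ≡ 0#
  inv-0 with 0# ≟ 0#
  ... | yes _   = refl
  ... | no  0≢0 = contradiction refl 0≢0

  *-inv : ∀ {x} → x ≢ 0# → x * inv x ≡ 1#
  *-inv {x} x≢0 with x ≟ 0#
  ... | yes x≡0 = contradiction x≡0 x≢0
  ... | no  x≢0 = proj₂ (inverse x x≢0)

  inv*x≡1 : ∀ {x} → x ≢ 0# → inv x * x ≡ 1#
  inv*x≡1 x≢0 = trans (*-comm _ _) (*-inv x≢0)

  x*[inv*y]≡y : ∀ {x} → x ≢ 0# → ∀ y → x * (inv x * y) ≡ y
  x*[inv*y]≡y {x} x≢0 y = trans (sym (*-assoc x (inv x) y)) (trans (cong (_* y) (*-inv x≢0)) (*-identityˡ y))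

  inv*[x*y]≡y : ∀ {x} → x ≢ 0# → ∀ y → inv x * (x * y) ≡ y
  inv*[x*y]≡y {x} x≢0 y = trans (sym (*-assoc (inv x) x y)) (trans (cong (_* y) (inv*x≡1 x≢0)) (*-identityˡ y))

  *-cancelʳ : ∀ {x y z} → z ≢ 0# → x * z ≡ y * z → x ≡ y
  *-cancelʳ {x} {y} {z} z≢0 eq = trans (undo x) (trans (cong (_* inv z) eq) (sym (undo y)))
    where
    undo : ∀ x → x ≡ x * z * inv z
    undo x = sym (trans (*-assoc x z (inv z)) (trans (cong (x *_) (*-inv z≢0)) (*-identityʳ x)))

  *-cancelˡ : ∀ {x y z} → z ≢ 0# → z * x ≡ z * y → x ≡ y
  *-cancelˡ z≢0 eq = *-cancelʳ z≢0 (trans (*-comm _ _) (trans eq (*-comm _ _)))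

  zero-product : ∀ {x y} → x * y ≡ 0# → x ≡ 0# ⊎ y ≡ 0#
  zero-product {x} {y} xy≡0 with y ≟ 0#
  ... | yes y≡0 = inj₂ y≡0
  ... | no  y≢0 = inj₁ (*-cancelʳ y≢0 (trans xy≡0 (sym (zeroˡ y))))

  *-nonzero : ∀ {x y} → x ≢ 0# → y ≢ 0# → x * y ≢ 0#
  *-nonzero x≢0 y≢0 = [ x≢0 , y≢0 ]′ ∘ zero-product

  inv-nonzero : ∀ {x} → x ≢ 0# → inv x ≢ 0#
  inv-nonzero {x} x≢0 inv≡0 = 0≢1 (trans (sym (zeroʳ x)) (trans (cong (x *_) (sym inv≡0)) (*-inv x≢0)))

  *-interchange : ∀ a b c d → a * b * (c * d) ≡ a * c * (b * d)
  *-interchange = solve 4 (λ a b c d → (a :* b) :* (c :* d) := (a :* c) :* (b :* d)) refl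

  inv-* : ∀ x y → inv (x * y) ≡ inv x * inv y
  inv-* x y = case x ≟ 0# of λ where
    (yes refl) → trans (cong inv (zeroˡ y)) (trans inv-0 (sym (trans (cong (_* inv y) inv-0) (zeroˡ _))))
    (no x≢0) → case y ≟ 0# of λ where
      (yes refl) → trans (cong inv (zeroʳ x)) (trans inv-0 (sym (trans (cong (inv x *_) inv-0) (zeroʳ _))))
      (no y≢0) → *-cancelˡ (*-nonzero x≢0 y≢0) (begin
        x * y * inv (x * y)       ≡⟨ *-inv (*-nonzero x≢0 y≢0) ⟩
        1#                        ≡⟨ *-identityˡ 1# ⟨
        1# * 1#                   ≡⟨ cong₂ _*_ (*-inv x≢0) (*-inv y≢0) ⟨
        x * inv x * (y * inv y)   ≡⟨ *-interchange x (inv x) y (inv y) ⟩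
        x * y * (inv x * inv y)   ∎)

  ^≡^ : ∀ x n → x ^ n ≡ x E.^ n
  ^≡^ x zero    = refl
  ^≡^ x (suc n) = cong (x *_) (^≡^ x n)

  ^-+ : ∀ x m n → x ^ (m ℕ.+ n) ≡ x ^ m * x ^ n
  ^-+ x m n = trans (^≡^ x (m ℕ.+ n)) (trans (E.^-homo-* x m n) (sym (cong₂ _*_ (^≡^ x m) (^≡^ x n))))

  ^-* : ∀ x m n → (x ^ m) ^ n ≡ x ^ (m ℕ.* n)
  ^-* x m n = trans (trans (^≡^ (x ^ m) n) (cong (E._^ n) (^≡^ x m)))
                    (trans (E.^-assocʳ x m n) (sym (^≡^ x (m ℕ.* n))))

  *-^ : ∀ x y n → (x * y) ^ n ≡ x ^ n * y ^ n
  *-^ x y n = trans (^≡^ (x * y) n) (trans (E.^-distrib-* x y n) (sym (cong₂ _*_ (^≡^ x n) (^≡^ y n))))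

  ^-nonzero : ∀ {x} n → x ≢ 0# → x ^ n ≢ 0#
  ^-nonzero zero    x≢0 = 0≢1 ∘ sym
  ^-nonzero (suc n) x≢0 = *-nonzero x≢0 (^-nonzero n x≢0)

  0^ : ∀ {n} → 0 < n → 0# ^ n ≡ 0#
  0^ {suc n} _ = zeroˡ (0# ^ n)

  permutation : ∀ (u v : K → K) → (∀ x → u (v x) ≡ x) → (∀ x → v (u x) ≡ x) → Perm.Permutation N N
  permutation u v uv vu = mk↔ₛ′ (conj u) (conj v) (conj-inverse u v uv) (conj-inverse v u vu)
    where
    conj : (K → K) → Fin N → Fin N
    conj u = to ∘ u ∘ from
    conj-inverse : ∀ u v → (∀ x → u (v x) ≡ x) → ∀ i → conj u (conj v i) ≡ i
    conj-inverse u v uv i = trans (cong (to ∘ u) (strictlyInverseʳ _)) (trans (cong to (uv _)) (strictlyInverseˡ i))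

  ∑ : (K → K) → K
  ∑ φ = sum (φ ∘ from)

  ∑-cong : ∀ {φ ψ : K → K} → (∀ x → φ x ≡ ψ x) → ∑ φ ≡ ∑ ψ
  ∑-cong eq = sum-cong-≗ (eq ∘ from)

  ∑-+ : ∀ (φ ψ : K → K) → ∑ (λ x → φ x + ψ x) ≡ ∑ φ + ∑ ψ
  ∑-+ φ ψ = ∑-distrib-+ (φ ∘ from) (ψ ∘ from)

  ∑-*ˡ : ∀ c (φ : K → K) → c * ∑ φ ≡ ∑ (λ x → c * φ x)
  ∑-*ˡ c φ = *-distribˡ-sum c (φ ∘ from)

  ∑-*ʳ : ∀ c (φ : K → K) → ∑ φ * c ≡ ∑ (λ x → φ x * c)
  ∑-*ʳ c φ = *-distribʳ-sum c (φ ∘ from)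

  ∑-permute : ∀ (φ u v : K → K) → (∀ x → u (v x) ≡ x) → (∀ x → v (u x) ≡ x) → ∑ φ ≡ ∑ (φ ∘ u)
  ∑-permute φ u v uv vu = trans (sum-permute (φ ∘ from) (permutation u v uv vu))
                                (sum-cong-≗ (λ i → cong φ (strictlyInverseʳ (u (from i)))))

  ∑-single : ∀ (φ : K → K) k → (∀ x → x ≢ k → φ x ≡ 0#) → ∑ φ ≡ φ k
  ∑-single φ k φ≡0 = trans (sum-single +-commutativeMonoid (φ ∘ from) (to k)
      (λ i i≢k → φ≡0 (from i) (λ eq → i≢k (from-injective (trans eq (sym (strictlyInverseʳ k)))))))
    (cong φ (strictlyInverseʳ k))

  ∑-const : ∀ x → ∑ (λ _ → x) ≡ N · x
  ∑-const x = sum-replicate N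

  -- An indicator with values in `K`: its sums count modulo the characteristic only, which is the
  -- precision of the slope argument.
  ⟦_⟧ : ∀ {P : Set} → Dec P → K
  ⟦ yes _ ⟧ = 1#
  ⟦ no  _ ⟧ = 0#

  ⟦⟧-cong : ∀ {P Q : Set} (P? : Dec P) (Q? : Dec Q) → (P → Q) → (Q → P) → ⟦ P? ⟧ ≡ ⟦ Q? ⟧
  ⟦⟧-cong (yes p) (yes q) f g = refl
  ⟦⟧-cong (yes p) (no ¬q) f g = contradiction (f p) ¬q
  ⟦⟧-cong (no ¬p) (yes q) f g = contradiction (g q) ¬p
  ⟦⟧-cong (no ¬p) (no ¬q) f g = refl

  -- Comparing ∑ x over the subgroup with its translate by x₀ shows |S| x₀ = 0.
  ∑-subgroup : ∀ {S : K → Set} (S? : ∀ x → Dec (S x)) x₀ → x₀ ≢ 0# →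
    (∀ x → S x → S (x + x₀)) → (∀ x → S (x + x₀) → S x) → ∑ (λ x → ⟦ S? x ⟧) ≡ 0#
  ∑-subgroup S? x₀ x₀≢0 S+ S- = *-cancelʳ x₀≢0 (trans |S|x₀≡0 (sym (zeroˡ x₀)))
    where
    sub-add : ∀ x → x + - x₀ + x₀ ≡ x
    sub-add x = trans (+-assoc x _ _) (trans (cong (x +_) (-‿inverseˡ x₀)) (+-identityʳ x))
    add-sub : ∀ x → x + x₀ + - x₀ ≡ x
    add-sub x = trans (+-assoc x _ _) (trans (cong (x +_) (-‿inverseʳ x₀)) (+-identityʳ x))
    T = ∑ (λ x → ⟦ S? x ⟧ * x)
    translate : T ≡ ∑ (λ x → ⟦ S? x ⟧) * x₀ + T
    translate = begin
      T ≡⟨ ∑-permute (λ x → ⟦ S? x ⟧ * x) (_+ x₀) (_+ - x₀) sub-add add-sub ⟩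
      ∑ (λ x → ⟦ S? (x + x₀) ⟧ * (x + x₀))
        ≡⟨ ∑-cong (λ x → trans (cong (_* (x + x₀)) (⟦⟧-cong (S? (x + x₀)) (S? x) (S- x) (S+ x)))
                               (trans (distribˡ _ x x₀) (+-comm _ _))) ⟩
      ∑ (λ x → ⟦ S? x ⟧ * x₀ + ⟦ S? x ⟧ * x)
        ≡⟨ ∑-+ (λ x → ⟦ S? x ⟧ * x₀) (λ x → ⟦ S? x ⟧ * x) ⟩
      ∑ (λ x → ⟦ S? x ⟧ * x₀) + T
        ≡⟨ cong (_+ T) (∑-*ʳ x₀ (λ x → ⟦ S? x ⟧)) ⟨
      ∑ (λ x → ⟦ S? x ⟧) * x₀ + T ∎
    |S|x₀≡0 : ∑ (λ x → ⟦ S? x ⟧) * x₀ ≡ 0#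
    |S|x₀≡0 = +-cancelʳ T _ _ (trans (sym translate) (sym (+-identityˡ T)))

  -- The whole field, taken as the additive subgroup, is stable under translation by 1.
  N·1≡0 : N · 1# ≡ 0#
  N·1≡0 = trans (sym (∑-const 1#)) (∑-subgroup (λ x → yes x) 1# (0≢1 ∘ sym) (λ x _ → x + 1#) (λ x _ → x))

  ∑-zero : ∑ (λ x → ⟦ x ≟ 0# ⟧) ≡ 1#
  ∑-zero = trans (∑-single _ 0# off) on
    where
    on : ⟦ 0# ≟ 0# ⟧ ≡ 1#
    on with 0# ≟ 0#
    ... | yes _  = refl
    ... | no 0≢0 = contradiction refl 0≢0
    off : ∀ x → x ≢ 0# → ⟦ x ≟ 0# ⟧ ≡ 0#
    off x x≢0 with x ≟ 0#
    ... | yes x≡0 = contradiction x≡0 x≢0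
    ... | no _    = refl

  ∑-nonzero : ∑ (λ x → ⟦ ¬? (x ≟ 0#) ⟧) + 1# ≡ 0#
  ∑-nonzero = begin
    ∑ (λ x → ⟦ ¬? (x ≟ 0#) ⟧) + 1#
      ≡⟨ cong (∑ (λ x → ⟦ ¬? (x ≟ 0#) ⟧) +_) ∑-zero ⟨
    ∑ (λ x → ⟦ ¬? (x ≟ 0#) ⟧) + ∑ (λ x → ⟦ x ≟ 0# ⟧)
      ≡⟨ ∑-+ (λ x → ⟦ ¬? (x ≟ 0#) ⟧) (λ x → ⟦ x ≟ 0# ⟧) ⟨
    ∑ (λ x → ⟦ ¬? (x ≟ 0#) ⟧ + ⟦ x ≟ 0# ⟧) ≡⟨ ∑-cong complement ⟩
    ∑ (λ _ → 1#) ≡⟨ ∑-const 1# ⟩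
    N · 1# ≡⟨ N·1≡0 ⟩
    0# ∎
    where
    complement : ∀ x → ⟦ ¬? (x ≟ 0#) ⟧ + ⟦ x ≟ 0# ⟧ ≡ 1#
    complement x with x ≟ 0#
    ... | yes _ = +-identityˡ 1#
    ... | no _ = +-identityʳ 1#

  -- Multiplication by x permutes the nonzero elements; c and e split the constant x over y ≢ 0 and y ≡ 0.
  fermat : 0 < N → ∀ x → x ^ N ≡ x
  fermat 0<N x with x ≟ 0#
  ... | yes refl = 0^ 0<N
  ... | no x≢0 = begin
    x ^ N                    ≡⟨ ^≡^ x N ⟩
    x E.^ N                  ≡⟨ Π.sum-replicate N ⟨
    Π.sum {N} (λ _ → x)          ≡⟨ Π.sum-cong-≗ (λ i → split (from i)) ⟩
    Π.sum (λ i → c (from i) * e (from i))          ≡⟨ Π.∑-distrib-+ (c ∘ from) (e ∘ from) ⟩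
    Π.sum (c ∘ from) * Π.sum (e ∘ from) ≡⟨ cong₂ _*_ Πc≡1 Πe≡x ⟩
    1# * x ≡⟨ *-identityˡ x ⟩
    x ∎
    where
    c e ψ : K → K
    c y with y ≟ 0#
    ... | yes _ = 1#
    ... | no _ = x
    e y with y ≟ 0#
    ... | yes _ = x
    ... | no _ = 1#
    ψ y with y ≟ 0#
    ... | yes _ = 1#
    ... | no _ = y
    split : ∀ y → x ≡ c y * e y
    split y with y ≟ 0#
    ... | yes _ = sym (*-identityˡ x)
    ... | no _ = sym (*-identityʳ x)
    ψ-scale : ∀ y → ψ (x * y) ≡ c y * ψ y
    ψ-scale y with y ≟ 0# | x * y ≟ 0#
    ... | yes _ | yes _ = sym (*-identityˡ 1#)
    ... | yes refl | no xy≢0 = contradiction (zeroʳ x) xy≢0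
    ... | no y≢0 | yes xy≡0 = contradiction xy≡0 (*-nonzero x≢0 y≢0)
    ... | no _ | no _ = refl
    ψ-nonzero : ∀ y → ψ y ≢ 0#
    ψ-nonzero y with y ≟ 0#
    ... | yes _ = 0≢1 ∘ sym
    ... | no y≢0 = y≢0
    Π-nonzero : ∀ {m} (f : Fin m → K) → (∀ i → f i ≢ 0#) → Π.sum f ≢ 0#
    Π-nonzero {zero} f f≢0 = 0≢1 ∘ sym
    Π-nonzero {suc m} f f≢0 = *-nonzero (f≢0 Fin.zero) (Π-nonzero (f ∘ Fin.suc) (f≢0 ∘ Fin.suc))
    e-0 : e 0# ≡ x
    e-0 with 0# ≟ 0#
    ... | yes _ = refl
    ... | no 0≢0 = contradiction refl 0≢0
    e-≢ : ∀ y → y ≢ 0# → e y ≡ 1#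
    e-≢ y y≢0 with y ≟ 0#
    ... | yes y≡0 = contradiction y≡0 y≢0
    ... | no _ = refl
    Πe≡x : Π.sum (e ∘ from) ≡ x
    Πe≡x = trans (sum-single *-commutativeMonoid (e ∘ from) (to 0#)
       (λ i i≢ → e-≢ (from i) (λ eq → i≢ (from-injective (trans eq (sym (strictlyInverseʳ 0#)))))))
      (trans (cong e (strictlyInverseʳ 0#)) e-0)
    -- `ψ` replaces the factor 0 by 1, so the product of its values is nonzero and can be cancelled
    -- after comparing it with the product permuted by x.
    Πc≡1 : Π.sum (c ∘ from) ≡ 1#
    Πc≡1 = *-cancelʳ (Π-nonzero (ψ ∘ from) (ψ-nonzero ∘ from)) (sym (begin
      1# * Π.sum (ψ ∘ from) ≡⟨ *-identityˡ _ ⟩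
      Π.sum (ψ ∘ from) ≡⟨ Π.sum-permute (ψ ∘ from) (permutation (x *_) (inv x *_) (x*[inv*y]≡y x≢0)
          (inv*[x*y]≡y x≢0)) ⟩
      Π.sum (λ i → ψ (from (to (x * from i)))) ≡⟨ Π.sum-cong-≗
          (λ i → trans (cong ψ (strictlyInverseʳ _)) (ψ-scale (from i))) ⟩
      Π.sum (λ i → c (from i) * ψ (from i)) ≡⟨ Π.∑-distrib-+ (c ∘ from) (ψ ∘ from) ⟩
      Π.sum (c ∘ from) * Π.sum (ψ ∘ from) ∎))

-- Root counting and power sums

module Sums {N : ℕ} (F : FiniteField N) where
  open FiniteField F
  open FieldTheory F
  open ≡-Reasoning

  -- Monic polynomials of degree d, given by their d lower coefficients, constant term first.
  eval : ∀ {d} → Vec K d → K → K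
  eval []      x = 1#
  eval (c ∷ p) x = c + x * eval p x

  -- Synthetic division by X - r (Horner's scheme); the remainder is the value at r.
  quot : ∀ {d} → Vec K (suc d) → K → Vec K d
  quot (c ∷ [])     r = []
  quot (c ∷ d ∷ p) r = eval (d ∷ p) r ∷ quot (d ∷ p) r

  -- p(x) − p(r) = (x − r) quot p r (x), with the negative terms moved so that it is a semiring identity.
  eval-quot : ∀ {d} (p : Vec K (suc d)) r x → eval p x + r * eval (quot p r) x ≡ x * eval (quot p r) x + eval p r
  eval-quot (c ∷ [])    r x = solve 4 (λ c r x i → ((c :+ x :* i) :+ r :* i) := (x :* i :+ (c :+ r :* i))) refl
      c r x 1#
  eval-quot (c ∷ d ∷ p) r x = begin
    c + x * P + r * (R + x * Q)
      ≡⟨ solve 6 (λ c r x P Q R → ((c :+ x :* P) :+ r :* (R :+ x :* Q)) :=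
          ((c :+ r :* R) :+ x :* (P :+ r :* Q))) refl c r x P Q R ⟩
    c + r * R + x * (P + r * Q)
      ≡⟨ cong (λ z → c + r * R + x * z) (eval-quot (d ∷ p) r x) ⟩
    c + r * R + x * (x * Q + R)
      ≡⟨ solve 5 (λ c r x Q R → ((c :+ r :* R) :+ x :* (x :* Q :+ R)) := (x :* (R :+ x :* Q) :+ (c :+ r :* R)))
          refl c r x Q R ⟩
    x * (R + x * Q) + (c + r * R) ∎
    where
    P = eval (d ∷ p) x
    R = eval (d ∷ p) r
    Q = eval (quot (d ∷ p) r) x

  #roots≤degree : ∀ {m d} (p : Vec K d) (ρ : Fin m → K) → (∀ {i j} → ρ i ≡ ρ j → i ≡ j) →
    (∀ i → eval p (ρ i) ≡ 0#) → m ≤ d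
  #roots≤degree {zero}  p  ρ inj root = z≤n
  #roots≤degree {suc m} [] ρ inj root = contradiction (sym (root Fin.zero)) 0≢1
  #roots≤degree {suc m} p@(_ ∷ _) ρ inj root =
    s≤s (#roots≤degree (quot p r) (ρ ∘ Fin.suc) (Fin.suc-injective ∘ inj) quot-root)
    where
    r = ρ Fin.zero
    quot-root : ∀ i → eval (quot p r) (ρ (Fin.suc i)) ≡ 0#
    quot-root i with eval (quot p r) (ρ (Fin.suc i)) ≟ 0#
    ... | yes eq  = eq
    -- At a further root x the division identity reads r Q = x Q, so a nonzero Q would identify two
    -- distinct roots.
    ... | no  neq = contradiction (inj (*-cancelʳ neq (begin
      r * Q             ≡⟨ +-identityˡ _ ⟨
      0# + r * Q        ≡⟨ cong (_+ r * Q) (root (Fin.suc i)) ⟨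
      eval p x + r * Q  ≡⟨ eval-quot p r x ⟩
      x * Q + eval p r  ≡⟨ cong (x * Q +_) (root Fin.zero) ⟩
      x * Q + 0#        ≡⟨ +-identityʳ _ ⟩
      x * Q             ∎))) Fin.0≢1+n
      where
      x = ρ (Fin.suc i)
      Q = eval (quot p r) x

  -- The polynomial X^(k+1+e) - X^k. It is monic, so its degree is visible in the type of `p`, and
  -- X^k is kept on the other side to avoid subtraction.
  power-difference : ∀ k e → ∃[ p ] (∀ x → eval {k ℕ.+ suc e} p x + x ^ k ≡ x ^ (k ℕ.+ suc e))
  power-difference zero e = - 1# ∷ Vec.replicate e 0# , λ x → begin
    - 1# + x * eval (Vec.replicate e 0#) x + 1#
      ≡⟨ solve 3 (λ a b c → ((a :+ b) :+ c) := (b :+ (a :+ c))) refl (- 1#) (x * eval (Vec.replicate e 0#) x) 1# ⟩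
    x * eval (Vec.replicate e 0#) x + (- 1# + 1#)
      ≡⟨ cong₂ _+_ (cong (x *_) (monomial e x)) (-‿inverseˡ 1#) ⟩
    x * x ^ e + 0#
      ≡⟨ +-identityʳ _ ⟩
    x * x ^ e ∎
    where
    monomial : ∀ e x → eval (Vec.replicate e 0#) x ≡ x ^ e
    monomial zero    x = refl
    monomial (suc e) x = trans (+-identityˡ _) (cong (x *_) (monomial e x))
  power-difference (suc k) e with p , eq ← power-difference k e = 0# ∷ p , λ x → begin
    0# + x * eval p x + x * x ^ k ≡⟨ cong (_+ x * x ^ k) (+-identityˡ _) ⟩
    x * eval p x + x * x ^ k      ≡⟨ distribˡ x _ _ ⟨
    x * (eval p x + x ^ k)        ≡⟨ cong (x *_) (eq x) ⟩
    x * x ^ (k ℕ.+ suc e)         ∎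

  -- Otherwise all N elements would be roots of the monic polynomial X^l - X^k of degree l < N.
  powers-distinct : ∀ {k l} → k < l → l < N → ¬ (∀ x → x ^ k ≡ x ^ l)
  powers-distinct {k} {l} k<l l<N same with p , eq ← power-difference k (l ∸ suc k) =
    ℕ.<⇒≱ l<N (subst (N ≤_) l≡ (#roots≤degree p from from-injective (λ i → vanish (from i))))
    where
    l≡ : k ℕ.+ suc (l ∸ suc k) ≡ l
    l≡ = trans (ℕ.+-suc k _) (ℕ.m+[n∸m]≡n k<l)
    vanish : ∀ x → eval p x ≡ 0#
    vanish x = +-cancelʳ (x ^ k) _ _ (begin
      eval p x + x ^ k           ≡⟨ eq x ⟩
      x ^ (k ℕ.+ suc (l ∸ suc k)) ≡⟨ cong (x ^_) l≡ ⟩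
      x ^ l                      ≡⟨ same x ⟨
      x ^ k                      ≡⟨ +-identityˡ _ ⟨
      0# + x ^ k                 ∎)

  power-injective : ∀ {k l} → k < N → l < N → (∀ x → x ^ k ≡ x ^ l) → k ≡ l
  power-injective {k} {l} k<N l<N same with ℕ.<-cmp k l
  ... | tri< k<l _ _ = contradiction same (powers-distinct k<l l<N)
  ... | tri≈ _ k≡l _ = k≡l
  ... | tri> _ _ k>l = contradiction (sym ∘ same) (powers-distinct k>l k<N)

  -- For l > 0 this is the sum of x^(k - l) over nonzero x. It is written as a ratio because k - l
  -- may be negative; the term at 0 contributes nothing.
  powerRatioSum : ℕ → ℕ → K
  powerRatioSum k l = ∑ (λ x → x ^ k * inv (x ^ l))

  -- Substituting u x for x multiplies the sum by u^k / u^l. If the sum were nonzero, u^k = u^l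
  -- would hold for all nonzero u, and also at 0 since both exponents are positive, so k and l would
  -- agree.
  powerRatioSum-≢ : ∀ {k l} → 0 < k → 0 < l → k < N → l < N → k ≢ l → powerRatioSum k l ≡ 0#
  powerRatioSum-≢ {k} {l} 0<k 0<l k<N l<N k≢l with powerRatioSum k l ≟ 0#
  ... | yes S≡0 = S≡0
  ... | no  S≢0 = contradiction (power-injective k<N l<N same) k≢l
    where
    S = powerRatioSum k l
    scale : ∀ {u} → u ≢ 0# → u ^ k * inv (u ^ l) * S ≡ S
    scale {u} u≢0 = sym (begin
      S ≡⟨ ∑-permute (λ x → x ^ k * inv (x ^ l)) (u *_) (inv u *_) (x*[inv*y]≡y u≢0) (inv*[x*y]≡y u≢0) ⟩
      ∑ (λ x → (u * x) ^ k * inv ((u * x) ^ l)) ≡⟨ ∑-cong (λ x → trans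
          (cong₂ _*_ (*-^ u x k) (trans (cong inv (*-^ u x l)) (inv-* _ _)))
          (*-interchange (u ^ k) (x ^ k) (inv (u ^ l)) (inv (x ^ l)))) ⟩
      ∑ (λ x → u ^ k * inv (u ^ l) * (x ^ k * inv (x ^ l))) ≡⟨ ∑-*ˡ _ (λ x → x ^ k * inv (x ^ l)) ⟨
      u ^ k * inv (u ^ l) * S ∎)
    same : ∀ x → x ^ k ≡ x ^ l
    same x with x ≟ 0#
    ... | yes refl = trans (0^ 0<k) (sym (0^ 0<l))
    ... | no x≢0 = *-cancelʳ (inv-nonzero (^-nonzero l x≢0))
      (trans (*-cancelʳ S≢0 (trans (scale x≢0) (sym (*-identityˡ S)))) (sym (*-inv (^-nonzero l x≢0))))

  powerRatioSum-≡ : ∀ {k} → 0 < k → powerRatioSum k k + 1# ≡ 0#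
  powerRatioSum-≡ {k} 0<k = trans (cong (_+ 1#) (∑-cong indicator)) ∑-nonzero
    where
    indicator : ∀ x → x ^ k * inv (x ^ k) ≡ ⟦ ¬? (x ≟ 0#) ⟧
    indicator x with x ≟ 0#
    ... | yes refl = trans (cong (_* inv (0# ^ k)) (0^ 0<k)) (zeroˡ _)
    ... | no x≢0 = *-inv (^-nonzero k x≢0)

  -- The characteristic, and additivity of its powers

  module _ {p k : ℕ} (pr : Prime p) (N≡p^k : N ≡ p ℕ.^ k) where

    -- N · 1 = 0 is a k-fold product of copies of p · 1, and a field has no zero divisors.
    characteristic : p · 1# ≡ 0#
    characteristic = go k (trans (cong (_· 1#) (sym N≡p^k)) N·1≡0)
      where
      go : ∀ j → (p ℕ.^ j) · 1# ≡ 0# → p · 1# ≡ 0#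
      go zero    eq = contradiction (trans (sym eq) (+-identityʳ 1#)) 0≢1
      go (suc j) eq with zero-product (trans (sym (M.×1-homo-* p (p ℕ.^ j))) eq)
      ... | inj₁ eq′ = eq′
      ... | inj₂ eq′ = go j eq′

    multiple-vanishes : ∀ {m} x → p ∣ m → m · x ≡ 0#
    multiple-vanishes x (divides m refl) = begin
      (m ℕ.* p) · x    ≡⟨ M.×-assocˡ x m p ⟨
      m · (p · x)      ≡⟨ cong (m ·_) p·x≡0 ⟩
      m · 0#           ≡⟨ sum-replicate m ⟨
      sum {m} (λ _ → 0#) ≡⟨ sum-replicate-zero m ⟩
      0#               ∎
      where
      p·x≡0 : p · x ≡ 0#
      p·x≡0 = trans (cong (p ·_) (sym (*-identityˡ x)))
                (trans (sym (M.×-assoc-* p 1# x)) (trans (cong (_* x) characteristic) (zeroˡ x)))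

    ^p-+ : ∀ x y → (x + y) ^ p ≡ x ^ p + y ^ p
    ^p-+ x y = expand p pr (λ j 0<j j<p → multiple-vanishes _ (prime∣C pr j 0<j j<p))
      where
      open BinomialTheorem commutativeSemiring using (theorem; binomialTerm; binomial)
      -- The exponent is rebound here so that it can be matched as a successor; the characteristic
      -- enters only through the vanishing of the middle binomial coefficients.
      expand : ∀ p → Prime p → (∀ {z} j → 0 < j → j < p → (p C j) · z ≡ 0#) → (x + y) ^ p ≡ x ^ p + y ^ p
      expand zero pr _ = contradiction pr ¬prime[0]
      expand p@(suc p-1) _ vanish = begin
        (x + y) ^ p ≡⟨ ^≡^ (x + y) p ⟩
        (x + y) E.^ p ≡⟨ theorem p x y ⟩
        binomialTerm x y p Fin.zero + sum {p} (λ i → binomialTerm x y p (Fin.suc i))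
          ≡⟨ cong₂ _+_ first (trans (sum-single +-commutativeMonoid (λ i → binomialTerm x y p (Fin.suc i))
              (Fin.fromℕ p-1) middle) last) ⟩
        y ^ p + x ^ p ≡⟨ +-comm _ _ ⟩
        x ^ p + y ^ p ∎
        where
        first : binomialTerm x y p Fin.zero ≡ y ^ p
        first = trans (M.×-homo-1 _) (trans (*-identityˡ _) (sym (^≡^ y p)))
        last : binomialTerm x y p (Fin.suc (Fin.fromℕ p-1)) ≡ x ^ p
        last rewrite Fin.toℕ-fromℕ p-1 | nCn≡1 p | ℕ.n∸n≡0 p-1 =
          trans (M.×-homo-1 _) (trans (*-identityʳ _) (sym (^≡^ x p)))
        middle : ∀ i → i ≢ Fin.fromℕ p-1 → binomialTerm x y p (Fin.suc i) ≡ 0#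
        middle i i≢ = vanish {binomial x y p (Fin.suc i)} (suc (toℕ i)) (s≤s z≤n)
            (s≤s (ℕ.≤∧≢⇒< (ℕ.≤-pred (Fin.toℕ<n i))
          (λ eq → i≢ (Fin.toℕ-injective (trans eq (sym (Fin.toℕ-fromℕ p-1)))))))

    ^p^-+ : ∀ j x y → (x + y) ^ (p ℕ.^ j) ≡ x ^ (p ℕ.^ j) + y ^ (p ℕ.^ j)
    ^p^-+ zero    x y = trans (*-identityʳ _) (sym (cong₂ _+_ (*-identityʳ x) (*-identityʳ y)))
    ^p^-+ (suc j) x y = begin
      (x + y) ^ (p ℕ.* p ℕ.^ j)                  ≡⟨ ^-* (x + y) p (p ℕ.^ j) ⟨
      ((x + y) ^ p) ^ (p ℕ.^ j)                ≡⟨ cong (_^ (p ℕ.^ j)) (^p-+ x y) ⟩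
      (x ^ p + y ^ p) ^ (p ℕ.^ j)              ≡⟨ ^p^-+ j (x ^ p) (y ^ p) ⟩
      (x ^ p) ^ (p ℕ.^ j) + (y ^ p) ^ (p ℕ.^ j) ≡⟨ cong₂ _+_ (^-* x p (p ℕ.^ j)) (^-* y p (p ℕ.^ j)) ⟩
      x ^ (p ℕ.* p ℕ.^ j) + y ^ (p ℕ.* p ℕ.^ j)  ∎

  -- Slopes of additive maps

  Additive : (K → K) → Set
  Additive f = ∀ x y → f (x + y) ≡ f x + f y

  -- Equivalently, ⟨(1, m)⟩ is a point of the linear set of f. Since that set misses ⟨(0, 1)⟩, its
  -- slopes describe it completely.
  Slope : (K → K) → K → Set
  Slope f m = ∃[ x ] (x ≢ 0# × f x ≡ m * x)

  additive-0 : ∀ {f} → Additive f → f 0# ≡ 0#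
  additive-0 {f} f-+ = +-cancelʳ (f 0#) _ _ (trans (sym (f-+ 0# 0#))
      (trans (cong f (+-identityˡ 0#)) (sym (+-identityˡ _))))

  line? : ∀ (f : K → K) m x → Dec (x ≢ 0# × f x ≡ m * x)
  line? f m x = ¬? (x ≟ 0#) ×-dec (f x ≟ m * x)

  slopeCount : (K → K) → K → K
  slopeCount f m = ∑ (λ x → ⟦ line? f m x ⟧)

  -- The solutions of f x = m x form an additive subgroup with a nonzero element `x₀`, so their
  -- number is 0 in `K`; leaving out x = 0 gives -1.
  slopeCount-Slope : ∀ {f} → Additive f → ∀ {m} → Slope f m → slopeCount f m + 1# ≡ 0#
  slopeCount-Slope {f} f-+ {m} (x₀ , x₀≢0 , fx₀) = begin
    slopeCount f m + 1# ≡⟨ cong (slopeCount f m +_) (sym ∑-zero) ⟩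
    slopeCount f m + ∑ (λ x → ⟦ x ≟ 0# ⟧) ≡⟨ ∑-+ (λ x → ⟦ line? f m x ⟧) (λ x → ⟦ x ≟ 0# ⟧) ⟨
    ∑ (λ x → ⟦ line? f m x ⟧ + ⟦ x ≟ 0# ⟧) ≡⟨ ∑-cong split ⟩
    ∑ (λ x → ⟦ f x ≟ m * x ⟧) ≡⟨ ∑-subgroup (λ x → f x ≟ m * x) x₀ x₀≢0
        (λ x fx → trans (f-+ x x₀) (trans (cong₂ _+_ fx fx₀) (sym (distribˡ m x x₀))))
        (λ x fx → +-cancelʳ (m * x₀) _ _ (trans (cong (f x +_) (sym fx₀))
            (trans (sym (f-+ x x₀)) (trans fx (distribˡ m x x₀))))) ⟩
    0# ∎
    where
    split : ∀ x → ⟦ line? f m x ⟧ + ⟦ x ≟ 0# ⟧ ≡ ⟦ f x ≟ m * x ⟧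
    split x with x ≟ 0# | f x ≟ m * x
    ... | yes _    | yes _  = +-identityˡ 1#
    ... | yes refl | no neq = contradiction (trans (additive-0 f-+) (sym (zeroʳ m))) neq
    ... | no _     | yes _  = +-identityʳ 1#
    ... | no _     | no _   = +-identityʳ 0#

  slopeCount-¬Slope : ∀ f {m} → ¬ Slope f m → slopeCount f m ≡ 0#
  slopeCount-¬Slope f {m} ¬slope = trans (∑-cong zero-term) (sum-replicate-zero N)
    where
    zero-term : ∀ x → ⟦ line? f m x ⟧ ≡ 0#
    zero-term x with line? f m x
    ... | yes line = contradiction (x , line) ¬slope
    ... | no _     = refl

  -- The count is -1 or 0 according to whether m is a slope, and sees nothing else of the map. The
  -- case distinction is decidable by search through the field.
  slopeCount-cong : ∀ {f g} → Additive f → Additive g → ∀ m → (Slope f m → Slope g m) → (Slope g m → Slope f m) →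
    slopeCount f m ≡ slopeCount g m
  slopeCount-cong {f} {g} f-+ g-+ m f⇒g g⇒f with any? (line? f m)
  ... | yes slope = +-cancelʳ 1# _ _ (trans (slopeCount-Slope f-+ slope) (sym (slopeCount-Slope g-+ (f⇒g slope))))
  ... | no ¬slope = trans (slopeCount-¬Slope f ¬slope) (sym (slopeCount-¬Slope g (¬slope ∘ g⇒f)))

  -- Each nonzero x is grouped with those having the same ratio m = f x / x, and the double sum is
  -- interchanged.
  ∑-by-slopes : ∀ (φ : K → K) → φ 0# ≡ 0# → ∀ f → ∑ (λ x → φ (f x * inv x)) ≡ ∑ (λ m → φ m * slopeCount f m)
  ∑-by-slopes φ φ0 f = begin
    ∑ (λ x → φ (f x * inv x)) ≡⟨ ∑-cong (sym ∘ inner) ⟩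
    ∑ (λ x → ∑ (λ m → φ m * ⟦ line? f m x ⟧)) ≡⟨ ∑-comm (λ i j → φ (from j) * ⟦ line? f (from j) (from i) ⟧) ⟩
    ∑ (λ m → ∑ (λ x → φ m * ⟦ line? f m x ⟧)) ≡⟨ ∑-cong (λ m → ∑-*ˡ (φ m) (λ x → ⟦ line? f m x ⟧)) ⟨
    ∑ (λ m → φ m * slopeCount f m) ∎
    where
    inner : ∀ x → ∑ (λ m → φ m * ⟦ line? f m x ⟧) ≡ φ (f x * inv x)
    inner x = trans (∑-single _ (f x * inv x) off) on
      where
      slope-unique : ∀ {m} → x ≢ 0# → f x ≡ m * x → m ≡ f x * inv x
      slope-unique {m} x≢0 fx = sym (trans (cong (_* inv x) fx)
        (trans (*-assoc m x (inv x)) (trans (cong (m *_) (*-inv x≢0)) (*-identityʳ m))))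
      off : ∀ m → m ≢ f x * inv x → φ m * ⟦ line? f m x ⟧ ≡ 0#
      off m m≢ with line? f m x
      ... | yes (x≢0 , fx) = contradiction (slope-unique x≢0 fx) m≢
      ... | no _ = zeroʳ (φ m)
      on : φ (f x * inv x) * ⟦ line? f (f x * inv x) x ⟧ ≡ φ (f x * inv x)
      on with line? f (f x * inv x) x
      ... | yes _ = *-identityʳ _
      ... | no ¬line = case x ≟ 0# of λ where
        -- x = 0 lies on no counted line, while its ratio is 0 by the convention for `inv`; the two
        -- sides agree because `φ 0# ≡ 0#`.
        (yes refl) → trans (zeroʳ _) (sym (trans (cong φ (trans (cong (f 0# *_) inv-0) (zeroʳ _))) φ0))
        (no x≢0) → contradiction (x≢0 , sym (trans (*-assoc _ _ _)
                (trans (cong (f x *_) (inv*x≡1 x≢0)) (*-identityʳ _)))) ¬line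

  ∑-slopes-cong : ∀ {f g} → Additive f → Additive g →
    (∀ m → Slope f m → Slope g m) → (∀ m → Slope g m → Slope f m) →
    ∀ (φ : K → K) → φ 0# ≡ 0# → ∑ (λ x → φ (f x * inv x)) ≡ ∑ (λ x → φ (g x * inv x))
  ∑-slopes-cong {f} {g} f-+ g-+ f⇒g g⇒f φ φ0 = trans (∑-by-slopes φ φ0 f)
    (trans (∑-cong (λ m → cong (φ m *_) (slopeCount-cong f-+ g-+ m (f⇒g m) (g⇒f m))))
           (sym (∑-by-slopes φ φ0 g)))

-- Exponents that are powers of q

^-injectiveʳ : ∀ {q} → 1 < q → ∀ {i j} → q ℕ.^ i ≡ q ℕ.^ j → i ≡ j
^-injectiveʳ {q} 1<q {i} {j} eq with ℕ.<-cmp i j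
... | tri< i<j _ _ = contradiction eq (ℕ.<⇒≢ (ℕ.^-monoʳ-< q 1<q i<j))
... | tri≈ _ i≡j _ = i≡j
... | tri> _ _ i>j = contradiction (sym eq) (ℕ.<⇒≢ (ℕ.^-monoʳ-< q 1<q i>j))

-- If both exponents on the left are positive, q divides the left side and q^(k+1), hence 1.
two-powers : ∀ {q} → 1 < q → ∀ i j k → q ℕ.^ i ℕ.+ q ℕ.^ j ≡ 1 ℕ.+ q ℕ.^ suc k →
  (i ≡ 0 × j ≡ suc k) ⊎ (i ≡ suc k × j ≡ 0)
two-powers 1<q zero j k eq = inj₁ (refl , ^-injectiveʳ 1<q (ℕ.suc-injective eq))
two-powers 1<q i@(suc _) zero k eq = inj₂ (^-injectiveʳ 1<q (ℕ.suc-injective (trans (ℕ.+-comm 1 _) eq)) , refl)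
two-powers {q} 1<q (suc i) (suc j) k eq = contradiction (∣1⇒≡1 q∣1) (ℕ.>⇒≢ 1<q)
  where
  q∣1 : q ∣ 1
  q∣1 = ∣m+n∣m⇒∣n (subst (q ∣_) (trans eq (ℕ.+-comm 1 _)) (∣m∣n⇒∣m+n (m∣m*n (q ℕ.^ i)) (m∣m*n (q ℕ.^ j))))
      (m∣m*n (q ℕ.^ k))

funToFin-cong : ∀ {m n} {f g : Fin m → Fin n} → (∀ i → f i ≡ g i) → Fin.funToFin f ≡ Fin.funToFin g
funToFin-cong {zero}  eq = refl
funToFin-cong {suc m} eq = cong₂ Fin.combine (eq Fin.zero) (funToFin-cong (eq ∘ Fin.suc))

-- Isolates what the theory of q-polynomials takes from q being a power of the characteristic.
PowerAdditive : ∀ {N} → FiniteField N → ℕ → Set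
PowerAdditive F q = ∀ x y → (x + y) ^ q ≡ x ^ q + y ^ q
  where open FiniteField F

-- q-polynomials and their coefficients

module QPolynomials {N : ℕ} (F : FiniteField N) (q n : ℕ) .{{_ : NonZero n}}
  (N≡q^n : N ≡ q ℕ.^ n) (2<q : 2 < q) (^q-+ : PowerAdditive F q) where

  open FiniteField F
  open FieldTheory F
  open Sums F
  open ≡-Reasoning

  1<q : 1 < q
  1<q = ℕ.<-trans (s≤s (s≤s z≤n)) 2<q

  instance
    q≢0 : NonZero q
    q≢0 = ℕ.>-nonZero (ℕ.<-trans (s≤s z≤n) 1<q)

  q^>0 : ∀ i → 0 < q ℕ.^ i
  q^>0 i = ℕ.m^n>0 q i

  q^i<N : ∀ {i} → i < n → q ℕ.^ i < N
  q^i<N i<n = subst (_ <_) (sym N≡q^n) (ℕ.^-monoʳ-< q 1<q i<n)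

  -- This is where q > 2 is needed.
  q^i+q^j<N : ∀ {i j} → i < n → j < n → q ℕ.^ i ℕ.+ q ℕ.^ j < N
  q^i+q^j<N {i} {j} i<n j<n = subst (_ <_) (sym N≡q^n) (go n i<n j<n)
    where
    go : ∀ n → i < n → j < n → q ℕ.^ i ℕ.+ q ℕ.^ j < q ℕ.^ n
    go (suc n) (s≤s i≤n) (s≤s j≤n) = ℕ.≤-<-trans
      (ℕ.+-mono-≤ (ℕ.^-monoʳ-≤ q i≤n) (ℕ.^-monoʳ-≤ q j≤n))
      (subst (_< q ℕ.* q ℕ.^ n) (cong (q ℕ.^ n ℕ.+_) (ℕ.+-identityʳ _))
        (ℕ.*-monoˡ-< (q ℕ.^ n) {{ℕ.m^n≢0 q n}} 2<q))

  χ : ℕ → K → K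
  χ i x = x ^ (q ℕ.^ i)

  χ-0 : ∀ x → χ 0 x ≡ x
  χ-0 = *-identityʳ

  χ-suc : ∀ i x → χ (suc i) x ≡ χ i (x ^ q)
  χ-suc i x = sym (^-* x q (q ℕ.^ i))

  χ-+ : ∀ i → Additive (χ i)
  χ-+ zero    x y = trans (χ-0 _) (sym (cong₂ _+_ (χ-0 x) (χ-0 y)))
  χ-+ (suc i) x y = begin
    χ (suc i) (x + y)         ≡⟨ χ-suc i (x + y) ⟩
    χ i ((x + y) ^ q)         ≡⟨ cong (χ i) (^q-+ x y) ⟩
    χ i (x ^ q + y ^ q)       ≡⟨ χ-+ i (x ^ q) (y ^ q) ⟩
    χ i (x ^ q) + χ i (y ^ q) ≡⟨ cong₂ _+_ (χ-suc i x) (χ-suc i y) ⟨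
    χ (suc i) x + χ (suc i) y ∎

  χ-* : ∀ i x y → χ i (x * y) ≡ χ i x * χ i y
  χ-* i x y = *-^ x y (q ℕ.^ i)

  χ-zero : ∀ i → χ i 0# ≡ 0#
  χ-zero i = 0^ (q^>0 i)

  χ-one : ∀ i → χ i 1# ≡ 1#
  χ-one i = 1^ (q ℕ.^ i)
    where
    1^ : ∀ m → 1# ^ m ≡ 1#
    1^ zero    = refl
    1^ (suc m) = trans (*-identityˡ _) (1^ m)

  χ-nonzero : ∀ i {x} → x ≢ 0# → χ i x ≢ 0#
  χ-nonzero i = ^-nonzero (q ℕ.^ i)

  χ-∘ : ∀ i j x → χ i (χ j x) ≡ χ (j ℕ.+ i) x
  χ-∘ i j x = trans (^-* x (q ℕ.^ j) (q ℕ.^ i)) (cong (x ^_) (sym (ℕ.^-distribˡ-+-* q j i)))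

  χ-periodic : ∀ i x → χ (i ℕ.+ n) x ≡ χ i x
  χ-periodic i x = begin
    χ (i ℕ.+ n) x ≡⟨ cong (λ k → χ k x) (ℕ.+-comm i n) ⟩
    χ (n ℕ.+ i) x ≡⟨ χ-∘ i n x ⟨
    χ i (χ n x)   ≡⟨ cong (χ i) (trans (cong (x ^_) (sym N≡q^n)) (fermat (subst (0 <_) (sym N≡q^n) (q^>0 n)) x)) ⟩
    χ i x         ∎

  χ-sum : ∀ i {m} (f : Fin m → K) → χ i (sum f) ≡ sum (χ i ∘ f)
  χ-sum i {zero}  f = χ-zero i
  χ-sum i {suc m} f = trans (χ-+ i _ _) (cong (χ i (f Fin.zero) +_) (χ-sum i (f ∘ Fin.suc)))

  Periodic : ∀ {A : Set} → (ℕ → A) → Set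
  Periodic g = ∀ i → g (i ℕ.+ n) ≡ g i

  ∑ₙ : (ℕ → K) → K
  ∑ₙ φ = sum {n} (φ ∘ toℕ)

  -- A shift by one trades the term φ 0 for φ n, and these agree by periodicity.
  ∑ₙ-shift : ∀ {φ} → Periodic φ → ∀ e → ∑ₙ (λ i → φ (i ℕ.+ e)) ≡ ∑ₙ φ
  ∑ₙ-shift {φ} per zero = sum-cong-≗ {n} (λ i → cong φ (ℕ.+-identityʳ (toℕ i)))
  ∑ₙ-shift {φ} per (suc e) = begin
    ∑ₙ (λ i → φ (i ℕ.+ suc e))     ≡⟨ sum-cong-≗ {n} (λ i → cong φ (ℕ.+-suc (toℕ i) e)) ⟩
    ∑ₙ (λ i → φ (suc (i ℕ.+ e)))   ≡⟨ ∑ₙ-shift {φ ∘ suc} (per ∘ suc) e ⟩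
    ∑ₙ (φ ∘ suc)                   ≡⟨ +-cancelˡ (φ 0) _ _
        (trans (sum-last n φ) (trans (+-comm _ _) (cong (_+ ∑ₙ φ) (per 0)))) ⟩
    ∑ₙ φ                           ∎
    where
    sum-last : ∀ m φ → φ 0 + sum {m} (φ ∘ suc ∘ toℕ) ≡ sum {m} (φ ∘ toℕ) + φ m
    sum-last zero    φ = +-comm (φ 0) 0#
    sum-last (suc m) φ = trans (cong (φ 0 +_) (sum-last m (φ ∘ suc))) (sym (+-assoc _ _ _))

  -- A q-polynomial is given by its coefficients, extended n-periodically.
  poly : (ℕ → K) → K → K
  poly g x = ∑ₙ (λ i → g i * χ i x)

  poly-+ : ∀ g → Additive (poly g)
  poly-+ g x y = trans (sum-cong-≗ {n} (λ i → trans (cong (g (toℕ i) *_) (χ-+ (toℕ i) x y)) (distribˡ _ _ _)))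
                       (∑-distrib-+ {n} (λ i → g (toℕ i) * χ (toℕ i) x) (λ i → g (toℕ i) * χ (toℕ i) y))

  poly-sum : ∀ g h x → poly (λ i → g i + h i) x ≡ poly g x + poly h x
  poly-sum g h x = trans (sum-cong-≗ {n} (λ i → distribʳ _ _ _))
                         (∑-distrib-+ {n} (λ i → g (toℕ i) * χ (toℕ i) x) (λ i → h (toℕ i) * χ (toℕ i) x))

  -- Coefficients of the q^k-th power of `poly g`, with exponents reduced by x^(q^n) = x. The index
  -- j - k modulo n is written `j ℕ.+ (n ∸ k)`, which periodicity permits.
  χ-poly : ℕ → (ℕ → K) → ℕ → K
  χ-poly k g j = χ k (g (j ℕ.+ (n ∸ k)))

  ∸-wrap : ∀ l {e} → e ≤ n → l ℕ.+ e ℕ.+ (n ∸ e) ≡ l ℕ.+ n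
  ∸-wrap l e≤n = trans (ℕ.+-assoc l _ _) (cong (l ℕ.+_) (ℕ.m+[n∸m]≡n e≤n))

  ∸-rotate : ∀ l e → l ℕ.+ n ℕ.+ (n ∸ e) ≡ l ℕ.+ (n ∸ e) ℕ.+ n
  ∸-rotate l e = trans (ℕ.+-assoc l n _) (trans (cong (l ℕ.+_) (ℕ.+-comm n _)) (sym (ℕ.+-assoc l _ n)))

  poly-χ-poly : ∀ {g} → Periodic g → ∀ {k} → k ≤ n → ∀ x → poly (χ-poly k g) x ≡ χ k (poly g x)
  poly-χ-poly {g} per {k} k≤n x = begin
    ∑ₙ φ                       ≡⟨ ∑ₙ-shift φ-periodic k ⟨
    ∑ₙ (λ j → φ (j ℕ.+ k))     ≡⟨ sum-cong-≗ {n} (λ j → term (toℕ j)) ⟩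
    ∑ₙ (λ j → χ k (g j * χ j x)) ≡⟨ χ-sum k {n} (λ j → g (toℕ j) * χ (toℕ j) x) ⟨
    χ k (poly g x)             ∎
    where
    φ : ℕ → K
    φ j = χ-poly k g j * χ j x
    φ-periodic : Periodic φ
    φ-periodic j = cong₂ _*_ (cong (χ k) (trans (cong g (∸-rotate j k)) (per _))) (χ-periodic j x)
    term : ∀ j → φ (j ℕ.+ k) ≡ χ k (g j * χ j x)
    term j = trans (cong₂ _*_ (cong (χ k) (trans (cong g (∸-wrap j k≤n)) (per j))) (sym (χ-∘ k j x)))
        (sym (χ-* k _ _))

  -- Coefficients of x ↦ `poly g (b * χ e x)`: the term of g at index l - e lands at l, again with
  -- `n ∸ e` standing for -e.
  comp-monomial : (ℕ → K) → K → ℕ → ℕ → K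
  comp-monomial g b e l = g (l ℕ.+ (n ∸ e)) * χ (l ℕ.+ (n ∸ e)) b

  comp-monomial-shift : ∀ {g} → Periodic g → ∀ b {e} → e ≤ n → ∀ l → comp-monomial g b e (l ℕ.+ e) ≡ g l * χ l b
  comp-monomial-shift {g} per b e≤n l = trans (cong (λ k → g k * χ k b) (∸-wrap l e≤n))
      (cong₂ _*_ (per l) (χ-periodic l b))

  poly-comp-monomial : ∀ {g} → Periodic g → ∀ b {e} → e ≤ n → ∀ x → poly (comp-monomial g b e) x ≡ poly g (b * χ e x)
  poly-comp-monomial {g} per b {e} e≤n x = begin
    ∑ₙ φ                       ≡⟨ ∑ₙ-shift φ-periodic e ⟨
    ∑ₙ (λ l → φ (l ℕ.+ e))     ≡⟨ sum-cong-≗ {n} (λ l → term (toℕ l)) ⟩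
    poly g (b * χ e x)         ∎
    where
    φ : ℕ → K
    φ l = comp-monomial g b e l * χ l x
    φ-periodic : Periodic φ
    φ-periodic l = cong₂ _*_ (cong₂ _*_ (trans (cong g (∸-rotate l e)) (per _))
                                        (trans (cong (λ k → χ k b) (∸-rotate l e)) (χ-periodic (l ℕ.+ (n ∸ e)) b)))
                             (χ-periodic l x)
    term : ∀ l → φ (l ℕ.+ e) ≡ g l * χ l (b * χ e x)
    term l = begin
      comp-monomial g b e (l ℕ.+ e) * χ (l ℕ.+ e) x
        ≡⟨ cong₂ _*_ (comp-monomial-shift per b e≤n l) (cong (λ k → χ k x) (ℕ.+-comm l e)) ⟩
      g l * χ l b * χ (e ℕ.+ l) x ≡⟨ cong (g l * χ l b *_) (χ-∘ l e x) ⟨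
      g l * χ l b * χ l (χ e x)   ≡⟨ *-assoc _ _ _ ⟩
      g l * (χ l b * χ l (χ e x)) ≡⟨ cong (g l *_) (χ-* l b _) ⟨
      g l * χ l (b * χ e x)       ∎

  -- A Kronecker delta on indices modulo n; the reduction makes it periodic.
  unit : ℕ → ℕ → K
  unit k i = ⟦ (i % n) ℕ.≟ k ⟧

  unit-periodic : ∀ k → Periodic (unit k)
  unit-periodic k i = cong (λ j → ⟦ j ℕ.≟ k ⟧) ([m+n]%n≡m%n i n)

  unit-≡ : ∀ {k} → k < n → unit k k ≡ 1#
  unit-≡ {k} k<n with (k % n) ℕ.≟ k
  ... | yes _  = refl
  ... | no neq = contradiction (m<n⇒m%n≡m k<n) neq

  unit-≢ : ∀ {k i} → i < n → i ≢ k → unit k i ≡ 0#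
  unit-≢ {k} {i} i<n i≢k with (i % n) ℕ.≟ k
  ... | yes eq = contradiction (trans (sym (m<n⇒m%n≡m i<n)) eq) i≢k
  ... | no _   = refl

  ∑ₙ-single : ∀ φ {k} → k < n → (∀ i → i < n → i ≢ k → φ i ≡ 0#) → ∑ₙ φ ≡ φ k
  ∑ₙ-single φ {k} k<n φ≡0 = trans
    (sum-single +-commutativeMonoid (φ ∘ toℕ) (fromℕ< k<n)
      (λ i i≢k → φ≡0 (toℕ i) (Fin.toℕ<n i) (λ eq → i≢k (Fin.toℕ-injective (trans eq (sym (Fin.toℕ-fromℕ< k<n)))))))
    (cong φ (Fin.toℕ-fromℕ< k<n))

  poly-unit : ∀ c {k} → k < n → ∀ x → poly (λ i → c * unit k i) x ≡ c * χ k x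
  poly-unit c {k} k<n x = trans
    (∑ₙ-single (λ i → c * unit k i * χ i x) k<n
      (λ i i<n i≢k → trans (cong (_* χ i x) (trans (cong (c *_) (unit-≢ i<n i≢k)) (zeroʳ c))) (zeroˡ _)))
    (cong (_* χ k x) (trans (cong (c *_) (unit-≡ k<n)) (*-identityʳ c)))

  binomial : K → ℕ → K → ℕ → ℕ → K
  binomial β₁ e₁ β₂ e₂ i = β₁ * unit e₁ i + β₂ * unit e₂ i

  binomial-periodic : ∀ β₁ e₁ β₂ e₂ → Periodic (binomial β₁ e₁ β₂ e₂)
  binomial-periodic β₁ e₁ β₂ e₂ i = cong₂ (λ u v → β₁ * u + β₂ * v) (unit-periodic e₁ i) (unit-periodic e₂ i)

  poly-binomial : ∀ β₁ {e₁} β₂ {e₂} → e₁ < n → e₂ < n → ∀ x →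
    poly (binomial β₁ e₁ β₂ e₂) x ≡ β₁ * χ e₁ x + β₂ * χ e₂ x
  poly-binomial β₁ {e₁} β₂ {e₂} e₁<n e₂<n x = trans (poly-sum (λ i → β₁ * unit e₁ i) (λ i → β₂ * unit e₂ i) x)
    (cong₂ _+_ (poly-unit β₁ e₁<n x) (poly-unit β₂ e₂<n x))

  binomial-first : ∀ β₁ {e₁} β₂ {e₂} → e₁ < n → e₁ ≢ e₂ → binomial β₁ e₁ β₂ e₂ e₁ ≡ β₁
  binomial-first β₁ β₂ e₁<n e₁≢e₂ = trans
    (cong₂ _+_ (trans (cong (β₁ *_) (unit-≡ e₁<n)) (*-identityʳ β₁)) (y≡0⇒x*y≡0 (unit-≢ e₁<n e₁≢e₂) β₂))
    (+-identityʳ β₁)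

  binomial-second : ∀ β₁ {e₁} β₂ {e₂} → e₂ < n → e₂ ≢ e₁ → binomial β₁ e₁ β₂ e₂ e₂ ≡ β₂
  binomial-second β₁ β₂ e₂<n e₂≢e₁ = trans (+-comm _ _) (binomial-first β₂ β₁ e₂<n e₂≢e₁)

  binomial-other : ∀ β₁ {e₁} β₂ {e₂} {i} → i < n → i ≢ e₁ → i ≢ e₂ → binomial β₁ e₁ β₂ e₂ i ≡ 0#
  binomial-other β₁ β₂ i<n i≢e₁ i≢e₂ = trans
    (cong₂ _+_ (y≡0⇒x*y≡0 (unit-≢ i<n i≢e₁) β₁) (y≡0⇒x*y≡0 (unit-≢ i<n i≢e₂) β₂))
    (+-identityʳ 0#)

  ∑-poly : ∀ g (ψ : K → K) → ∑ (λ x → poly g x * ψ x) ≡ ∑ₙ (λ i → g i * ∑ (λ x → χ i x * ψ x))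
  ∑-poly g ψ = begin
    ∑ (λ x → poly g x * ψ x)
      ≡⟨ ∑-cong (λ x → trans (*-distribʳ-sum {n} (ψ x) (λ i → g (toℕ i) * χ (toℕ i) x))
                             (sum-cong-≗ {n} (λ i → *-assoc _ _ _))) ⟩
    ∑ (λ x → ∑ₙ (λ i → g i * (χ i x * ψ x)))
      ≡⟨ ∑-comm {N} {n} (λ x i → g (toℕ i) * (χ (toℕ i) (from x) * ψ (from x))) ⟩
    ∑ₙ (λ i → ∑ (λ x → g i * (χ i x * ψ x)))
      ≡⟨ sum-cong-≗ {n} (λ i → ∑-*ˡ (g (toℕ i)) (λ x → χ (toℕ i) x * ψ x)) ⟨
    ∑ₙ (λ i → g i * ∑ (λ x → χ i x * ψ x)) ∎

  -- Dividing by x^(q^k) and summing isolates one coefficient: the exponents q^i are distinct and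
  -- below N, so every other power sum vanishes, and the one at i = k is -1.
  coefficient : ∀ g {k} → k < n → ∑ (λ x → poly g x * inv (χ k x)) + g k ≡ 0#
  coefficient g {k} k<n = begin
    ∑ (λ x → poly g x * inv (χ k x)) + g k
      ≡⟨ cong (_+ g k) (trans (∑-poly g (λ x → inv (χ k x)))
           (∑ₙ-single (λ i → g i * powerRatioSum (q ℕ.^ i) (q ℕ.^ k)) k<n off)) ⟩
    g k * powerRatioSum (q ℕ.^ k) (q ℕ.^ k) + g k ≡⟨ cong (g k * powerRatioSum (q ℕ.^ k) (q ℕ.^ k) +_)
        (*-identityʳ (g k)) ⟨
    g k * powerRatioSum (q ℕ.^ k) (q ℕ.^ k) + g k * 1# ≡⟨ distribˡ (g k) _ _ ⟨
    g k * (powerRatioSum (q ℕ.^ k) (q ℕ.^ k) + 1#) ≡⟨ cong (g k *_) (powerRatioSum-≡ (q^>0 k)) ⟩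
    g k * 0# ≡⟨ zeroʳ (g k) ⟩
    0# ∎
    where
    off : ∀ i → i < n → i ≢ k → g i * powerRatioSum (q ℕ.^ i) (q ℕ.^ k) ≡ 0#
    off i i<n i≢k = trans (cong (g i *_) (powerRatioSum-≢ (q^>0 i) (q^>0 k) (q^i<N i<n) (q^i<N k<n)
      (λ eq → i≢k (^-injectiveʳ 1<q eq)))) (zeroʳ (g i))

  poly-injective : ∀ {g h} → (∀ x → poly g x ≡ poly h x) → ∀ {k} → k < n → g k ≡ h k
  poly-injective {g} {h} eq {k} k<n = +-cancelˡ (∑ (λ x → poly g x * inv (χ k x))) _ _
    (trans (coefficient g k<n) (sym (trans (cong (_+ h k) (∑-cong (λ x → cong (_* inv (χ k x)) (eq x))))
        (coefficient h k<n))))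

  0<n : 0 < n
  0<n = ℕ.>-nonZero⁻¹ n

  -- The power sum of φ(m) = m · m^(q^k) over the values m = g(x)/x.
  quadratic-sum : ∀ {g} → Periodic g → g 0 ≡ 0# → ∀ {k} → 0 < k → k < n →
    ∑ (λ x → poly g x * inv x * χ k (poly g x * inv x)) + g k * χ k (g (n ∸ k)) ≡ 0#
  quadratic-sum {g} per g0≡0 {k@(suc k-1)} 0<k k<n = begin
    ∑ (λ x → poly g x * inv x * χ k (poly g x * inv x)) + g k * χ k (g (n ∸ k))
      ≡⟨ cong (_+ g k * χ k (g (n ∸ k))) (trans (∑-cong (λ x → *-assoc (poly g x) (inv x)
          (χ k (poly g x * inv x)))) (trans (∑-poly g ψ) (∑ₙ-single (λ i → g i * R i) k<n off))) ⟩
    g k * R k + g k * χ k (g (n ∸ k)) ≡⟨ distribˡ (g k) _ _ ⟨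
    g k * (R k + χ k (g (n ∸ k))) ≡⟨ cong (λ r → g k * (r + χ k (g (n ∸ k)))) Rk ⟩
    g k * (∑ (λ x → poly g′ x * inv (χ 0 x)) + g′ 0) ≡⟨ cong (g k *_) (coefficient g′ 0<n) ⟩
    g k * 0# ≡⟨ zeroʳ (g k) ⟩
    0# ∎
    where
    g′ : ℕ → K
    g′ = χ-poly k g
    ψ : K → K
    ψ x = inv x * χ k (poly g x * inv x)
    R : ℕ → K
    R i = ∑ (λ x → χ i x * ψ x)
    χ-inv : ∀ {x} → x ≢ 0# → χ k (inv x) * χ k x ≡ 1#
    χ-inv {x} x≢0 = trans (sym (χ-* k (inv x) x)) (trans (cong (χ k) (inv*x≡1 x≢0)) (χ-one k))
    χ-inv′ : ∀ x → χ k (inv x) ≡ inv (χ k x)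
    χ-inv′ x = case x ≟ 0# of λ where
      (yes refl) → trans (cong (χ k) inv-0) (trans (χ-zero k) (sym (trans (cong inv (χ-zero k)) inv-0)))
      (no x≢0) → *-cancelʳ (χ-nonzero k x≢0) (trans (χ-inv x≢0) (sym (inv*x≡1 (χ-nonzero k x≢0))))
    ψ-expand : ∀ x → ψ x ≡ poly g′ x * (inv x * inv (χ k x))
    ψ-expand x = trans (cong (inv x *_) (trans (χ-* k _ _)
        (cong₂ _*_ (sym (poly-χ-poly per (ℕ.<⇒≤ k<n) x)) (χ-inv′ x))))
      (solve 3 (λ a b c → a :* (b :* c) := b :* (a :* c)) refl (inv x) (poly g′ x) (inv (χ k x)))
    -- For i = k the factor `χ k x` cancels, and what remains extracts the coefficient of X in the
    -- q^k-th power of `poly g`: this is `g′ 0`, by definition `χ k (g (n ∸ k))`.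
    Rk : R k ≡ ∑ (λ x → poly g′ x * inv (χ 0 x))
    Rk = ∑-cong (λ x → trans (cong (χ k x *_) (ψ-expand x)) (case x ≟ 0# of λ where
      (yes refl) → trans (x≡0⇒x*y≡0 (χ-zero k) _) (sym (y≡0⇒x*y≡0 (trans (cong inv (χ-zero 0)) inv-0) (poly g′ 0#)))
      (no x≢0) → trans (solve 4 (λ a b c d → a :* (b :* (c :* d)) := (b :* c) :* (a :* d)) refl (χ k x)
          (poly g′ x) (inv x) (inv (χ k x)))
         (trans (cong (poly g′ x * inv x *_) (*-inv (χ-nonzero k x≢0)))
             (trans (*-identityʳ _) (cong (λ z → poly g′ x * inv z) (sym (χ-0 x)))))))
    off : ∀ i → i < n → i ≢ k → g i * R i ≡ 0#
    -- At i = 0 the choice j = k also produces the exponent 1 + q^k, so this cross term is removed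
    -- by `g 0 ≡ 0#` and not by the power sums.
    off zero i<n i≢k = trans (cong (_* R 0) g0≡0) (zeroˡ _)
    off i@(suc _) i<n i≢k = trans (cong (g i *_) Ri≡0) (zeroʳ (g i))
      where
      term : ∀ j x → χ j x * (χ i x * (inv x * inv (χ k x))) ≡ x ^ (q ℕ.^ i ℕ.+ q ℕ.^ j) * inv (x ^ (1 ℕ.+ q ℕ.^ k))
      term j x = trans (solve 4 (λ a b c d → a :* (b :* (c :* d)) := (b :* a) :* (c :* d)) refl (χ j x) (χ i x)
          (inv x) (inv (χ k x)))
        (cong₂ _*_ (sym (^-+ x (q ℕ.^ i) (q ℕ.^ j))) (sym (inv-* x (χ k x))))
      Ri≡0 : R i ≡ 0#
      Ri≡0 = begin
        R i ≡⟨ ∑-cong (λ x → trans (cong (χ i x *_) (ψ-expand x))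
                 (solve 4 (λ a b c d → a :* (b :* (c :* d)) := b :* (a :* (c :* d))) refl (χ i x) (poly g′ x)
                     (inv x) (inv (χ k x)))) ⟩
        ∑ (λ x → poly g′ x * (χ i x * (inv x * inv (χ k x))))
          ≡⟨ ∑-poly g′ (λ x → χ i x * (inv x * inv (χ k x))) ⟩
        ∑ₙ (λ j → g′ j * ∑ (λ x → χ j x * (χ i x * (inv x * inv (χ k x)))))
          ≡⟨ sum-cong-≗ {n} (λ j → trans (cong (g′ (toℕ j) *_)
              (trans (∑-cong (term (toℕ j))) (vanish (Fin.toℕ<n j)))) (zeroʳ _)) ⟩
        sum {n} (λ _ → 0#) ≡⟨ sum-replicate-zero n ⟩
        0# ∎
        where
        vanish : ∀ {j} → j < n → powerRatioSum (q ℕ.^ i ℕ.+ q ℕ.^ j) (1 ℕ.+ q ℕ.^ k) ≡ 0#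
        vanish {j} j<n = powerRatioSum-≢ (ℕ.<-≤-trans (q^>0 i) (ℕ.m≤m+n _ _)) (s≤s z≤n) (q^i+q^j<N i<n j<n)
            (q^i+q^j<N 0<n k<n)
          (λ eq → case two-powers 1<q i j k-1 eq of λ where
            (inj₁ (() , _))
            (inj₂ (i≡k , _)) → i≢k i≡k)

  module _ {g h} (g-per : Periodic g) (h-per : Periodic h)
    (g⇒h : ∀ m → Slope (poly g) m → Slope (poly h) m) (h⇒g : ∀ m → Slope (poly h) m → Slope (poly g) m) where

    slopes⇒coefficient₀ : g 0 ≡ h 0
    slopes⇒coefficient₀ = +-cancelˡ (∑ (λ x → poly g x * inv x)) _ _ (trans (constant g) (sym
        (trans (cong (_+ h 0) (∑-slopes-cong (poly-+ g) (poly-+ h) g⇒h h⇒g id refl)) (constant h))))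
      where
      constant : ∀ g → ∑ (λ x → poly g x * inv x) + g 0 ≡ 0#
      constant g = trans (cong (_+ g 0) (∑-cong (λ x → cong (λ z → poly g x * inv z) (sym (χ-0 x)))))
          (coefficient g 0<n)

    slopes⇒quadratic : g 0 ≡ 0# → ∀ {k} → 0 < k → k < n → g k * χ k (g (n ∸ k)) ≡ h k * χ k (h (n ∸ k))
    slopes⇒quadratic g0≡0 {k} 0<k k<n = +-cancelˡ (∑ (λ x → poly g x * inv x * χ k (poly g x * inv x))) _ _
      (trans (quadratic-sum g-per g0≡0 0<k k<n) (sym (trans
        (cong (_+ h k * χ k (h (n ∸ k)))
          (∑-slopes-cong (poly-+ g) (poly-+ h) g⇒h h⇒g (λ m → m * χ k m) (zeroˡ _)))
        (quadratic-sum h-per (trans (sym slopes⇒coefficient₀) g0≡0) 0<k k<n))))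

  -- P = a X + b₁ X^(q^e₁) + b₂ X^(q^e₂); composing with P on the right is an injective,
  -- hence surjective, self-map of the finite set of q-polynomials.
  module _ (a b₁ b₂ : K) {e₁ e₂ : ℕ} (e₁≤n : e₁ ≤ n) (e₂≤n : e₂ ≤ n) where

    trinomial : K → K
    trinomial x = a * x + (b₁ * χ e₁ x + b₂ * χ e₂ x)

    comp-trinomial : (ℕ → K) → ℕ → K
    comp-trinomial g l = g l * χ l a + (comp-monomial g b₁ e₁ l + comp-monomial g b₂ e₂ l)

    poly-comp-trinomial : ∀ {g} → Periodic g → ∀ x → poly (comp-trinomial g) x ≡ poly g (trinomial x)
    poly-comp-trinomial {g} per x = begin
      poly (comp-trinomial g) x ≡⟨ poly-sum (λ l → g l * χ l a)
          (λ l → comp-monomial g b₁ e₁ l + comp-monomial g b₂ e₂ l) x ⟩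
      poly (λ l → g l * χ l a) x + poly (λ l → comp-monomial g b₁ e₁ l + comp-monomial g b₂ e₂ l) x
        ≡⟨ cong₂ _+_ (sum-cong-≗ {n} (λ l → trans (*-assoc _ _ _) (cong (g (toℕ l) *_) (sym (χ-* (toℕ l) a x)))))
             (trans (poly-sum (comp-monomial g b₁ e₁) (comp-monomial g b₂ e₂) x)
                 (cong₂ _+_ (poly-comp-monomial per b₁ e₁≤n x) (poly-comp-monomial per b₂ e₂≤n x))) ⟩
      poly g (a * x) + (poly g (b₁ * χ e₁ x) + poly g (b₂ * χ e₂ x))
        ≡⟨ trans (poly-+ g _ _) (cong (_ +_) (poly-+ g _ _)) ⟨
      poly g (trinomial x) ∎

    trinomial-+ : Additive trinomial
    trinomial-+ x y = begin
      trinomial (x + y) ≡⟨ cong (a * (x + y) +_) (cong₂ _+_ (cong (b₁ *_) (χ-+ e₁ x y)) (cong (b₂ *_) (χ-+ e₂ x y))) ⟩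
      a * (x + y) + (b₁ * (χ e₁ x + χ e₁ y) + b₂ * (χ e₂ x + χ e₂ y))
        ≡⟨ solve 9 (λ a b₁ b₂ x y x₁ y₁ x₂ y₂ → (a :* (x :+ y) :+ (b₁ :* (x₁ :+ y₁) :+ b₂ :* (x₂ :+ y₂))) :=
             ((a :* x :+ (b₁ :* x₁ :+ b₂ :* x₂)) :+ (a :* y :+ (b₁ :* y₁ :+ b₂ :* y₂)))) refl a b₁ b₂ x y
                 (χ e₁ x) (χ e₁ y) (χ e₂ x) (χ e₂ y) ⟩
      trinomial x + trinomial y ∎

    module _ (kernel : ∀ x → x ≢ 0# → trinomial x ≢ 0#) where

      trinomial-injective : ∀ {x y} → trinomial x ≡ trinomial y → x ≡ y
      trinomial-injective {x} {y} eq with x + - y ≟ 0#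
      ... | yes x-y≡0 = +-cancelʳ (- y) _ _ (trans x-y≡0 (sym (-‿inverseʳ y)))
      ... | no  x-y≢0 = contradiction (+-cancelʳ (trinomial y) _ _ (begin
        trinomial (x + - y) + trinomial y ≡⟨ trinomial-+ (x + - y) y ⟨
        trinomial (x + - y + y) ≡⟨ cong trinomial (trans (+-assoc x _ _)
            (trans (cong (x +_) (-‿inverseˡ y)) (+-identityʳ x))) ⟩
        trinomial x ≡⟨ eq ⟩
        trinomial y ≡⟨ +-identityˡ _ ⟨
        0# + trinomial y ∎)) (kernel _ x-y≢0)

      trinomial-surjective : ∀ y → ∃[ x ] trinomial x ≡ y
      trinomial-surjective y with i , eq ← injective⇒surjective (to ∘ trinomial ∘ from)
          (from-injective ∘ trinomial-injective ∘ to-injective) (to y) = from i , to-injective eq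

      -- A periodic sequence is given by its first n entries. Coding these by `Fin (N ℕ.^ n)` brings
      -- q-polynomials under `injective⇒surjective`.
      decode : Fin (N ℕ.^ n) → ℕ → K
      decode c l = from (Fin.finToFun {N} {n} c (l mod n))

      decode-periodic : ∀ c → Periodic (decode c)
      decode-periodic c l = cong (λ k → from (Fin.finToFun {N} {n} c k))
          (Fin.toℕ-injective (trans (Fin.toℕ-fromℕ< _) (trans ([m+n]%n≡m%n l n) (sym (Fin.toℕ-fromℕ< _)))))

      encode : (ℕ → K) → Fin (N ℕ.^ n)
      encode g = Fin.funToFin {n} {N} (λ l → to (g (toℕ l)))

      encode-reflects : ∀ {g h} → encode g ≡ encode h → ∀ (l : Fin n) → g (toℕ l) ≡ h (toℕ l)
      encode-reflects {g} {h} eq l = to-injective (trans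
          (sym (Fin.finToFun-funToFin {n} {N} (λ l → to (g (toℕ l))) l))
        (trans (cong (λ c → Fin.finToFun {N} {n} c l) eq) (Fin.finToFun-funToFin {n} {N} (λ l → to (h (toℕ l))) l)))

      encode-cong : ∀ {g h} → (∀ (l : Fin n) → g (toℕ l) ≡ h (toℕ l)) → encode g ≡ encode h
      encode-cong eq = funToFin-cong {n} {N} (cong to ∘ eq)

      encode-decode : ∀ c → encode (decode c) ≡ c
      encode-decode c = trans (funToFin-cong {n} {N} (λ l → trans (strictlyInverseˡ _)
          (cong (Fin.finToFun {N} {n} c) (Fin.toℕ-injective (trans (Fin.toℕ-fromℕ< _) (m<n⇒m%n≡m (Fin.toℕ<n l)))))))
        (Fin.funToFin-finToFin {n} {N} c)

      -- Two q-polynomials that agree after composition with the trinomial agree everywhere, because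
      -- the trinomial is onto; equal functions have equal coefficients.
      comp-trinomial-injective : ∀ {c d} →
        encode (comp-trinomial (decode c)) ≡ encode (comp-trinomial (decode d)) → c ≡ d
      comp-trinomial-injective {c} {d} eq = trans (sym (encode-decode c)) (trans
          (encode-cong {decode c} {decode d} (λ l → poly-injective {decode c} {decode d} same (Fin.toℕ<n l)))
          (encode-decode d))
        where
        same : ∀ y → poly (decode c) y ≡ poly (decode d) y
        same y with x , refl ← trinomial-surjective y = begin
          poly (decode c) (trinomial x)      ≡⟨ poly-comp-trinomial (decode-periodic c) x ⟨
          poly (comp-trinomial (decode c)) x ≡⟨ sum-cong-≗ {n} (λ l → cong (_* χ (toℕ l) x)
                                                  (encode-reflects {comp-trinomial (decode c)}
                                                      {comp-trinomial (decode d)} eq l)) ⟩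
          poly (comp-trinomial (decode d)) x ≡⟨ poly-comp-trinomial (decode-periodic d) x ⟩
          poly (decode d) (trinomial x)      ∎

      -- Right division by the trinomial. With the numerator as `Q` it yields Q ∘ P⁻¹ as a
      -- q-polynomial.
      comp-trinomial-surjective : ∀ Q → ∃[ g ] (Periodic g × (∀ {k} → k < n → comp-trinomial g k ≡ Q k) ×
          (∀ x → poly g (trinomial x) ≡ poly Q x))
      comp-trinomial-surjective Q with c , eq ← injective⇒surjective (encode ∘ comp-trinomial ∘ decode)
          comp-trinomial-injective (encode Q) =
        decode c , decode-periodic c , (λ k<n → subst (λ k → comp-trinomial (decode c) k ≡ Q k)
            (Fin.toℕ-fromℕ< k<n) (eq′ (fromℕ< k<n)))
          , (λ x → trans (sym (poly-comp-trinomial (decode-periodic c) x))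
              (sum-cong-≗ {n} (λ l → cong (_* χ (toℕ l) x) (eq′ l))))
        where
        eq′ : ∀ l → comp-trinomial (decode c) (toℕ l) ≡ Q (toℕ l)
        eq′ = encode-reflects {comp-trinomial (decode c)} {Q} eq

-- The action of a semilinear map on linear sets

module Collineation {N : ℕ} (F : FiniteField N) (γ : FiniteField.GammaL2 F) where
  open FiniteField F
  open FieldTheory F
  open ≡-Reasoning
  open GammaL2 γ
  open FieldAut aut

  σ-0 : σ 0# ≡ 0#
  σ-0 = Sums.additive-0 F pres-+

  σ-nonzero : ∀ {x} → x ≢ 0# → σ x ≢ 0#
  σ-nonzero x≢0 σx≡0 = x≢0 (proj₁ bij (trans σx≡0 (sym σ-0)))

  σ-reflects-nonzero : ∀ {x} → σ x ≢ 0# → x ≢ 0#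
  σ-reflects-nonzero σx≢0 x≡0 = σx≢0 (trans (cong σ x≡0) σ-0)

  σ-surjective : ∀ y → ∃[ x ] σ x ≡ y
  σ-surjective y with x , eq ← proj₂ bij y = x , eq refl

  σ-^ : ∀ x m → σ (x ^ m) ≡ σ x ^ m
  σ-^ x zero    = pres-1
  σ-^ x (suc m) = trans (pres-* x (x ^ m)) (cong (σ x *_) (σ-^ x m))

  ¬singular : a * d ≡ 0# → b * c ≡ 0# → ⊥
  ¬singular ad≡0 bc≡0 = det≢0 (trans (cong₂ (λ u v → u + - v) ad≡0 bc≡0) (-‿inverseʳ 0#))

  -- Eliminating `t` gives (a d - b c) s = 0. Applied with s = y, it shows that (P y, Q y) is a
  -- nonzero vector whenever y is nonzero.
  matrix-kernel : ∀ {s t} → a * s + b * t ≡ 0# → c * s + d * t ≡ 0# → s ≡ 0#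
  matrix-kernel {s} {t} eq₁ eq₂ with s ≟ 0#
  ... | yes s≡0 = s≡0
  ... | no  s≢0 = contradiction (trans (cong (_+ - (b * c)) ad≡bc) (-‿inverseʳ (b * c))) det≢0
    where
    ad≡bc : a * d ≡ b * c
    ad≡bc = *-cancelʳ s≢0 (+-cancelʳ (b * d * t) _ _ (begin
      a * d * s + b * d * t ≡⟨ solve 5 (λ a b d s t → a :* d :* s :+ b :* d :* t := d :* (a :* s :+ b :* t))
          refl a b d s t ⟩
      d * (a * s + b * t)   ≡⟨ y≡0⇒x*y≡0 eq₁ d ⟩
      0#                    ≡⟨ y≡0⇒x*y≡0 eq₂ b ⟨
      b * (c * s + d * t)   ≡⟨ solve 5 (λ b c d s t → b :* (c :* s :+ d :* t) := b :* c :* s :+ b :* d :* t)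
          refl b c d s t ⟩
      b * c * s + b * d * t ∎))

  module _ {f f′ h : K → K} (σ-f : ∀ x → σ (f x) ≡ f′ (σ x)) (image : ImageEq γ (LinSet f) (LinSet h)) where

    private
      P Q : K → K
      P y = a * y + b * f′ y
      Q y = c * y + d * f′ y

    -- (P y, Q y) is the image of a point of L_f, so it is proportional to some (x, h x) with x
    -- nonzero; this excludes P y = 0. The equation is the equality of the slopes h x / x and Q y /
    -- P y, cross-multiplied.
    image⊆ : ∀ {y} → y ≢ 0# → P y ≢ 0# × ∃[ x ] (x ≢ 0# × h x * P y ≡ Q y * x)
    image⊆ {y} y≢0 with x , refl ← σ-surjective y
      with z , z≢0 , λ′ , _ , z≡ , hz≡ ← Equivalence.from
          (image (P (σ x) , Q (σ x)) (y≢0 ∘ λ (Py≡0 , Qy≡0) → matrix-kernel Py≡0 Qy≡0))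
        ((x , f x) , σ-reflects-nonzero y≢0 ∘ proj₁ , (x , σ-reflects-nonzero y≢0 , 1# , 0≢1 ∘ sym ,
            sym (*-identityˡ _) , sym (*-identityˡ _)) ,
         1# , 0≢1 ∘ sym , sym (trans (*-identityˡ _) (cong (λ t → a * σ x + b * t) (σ-f x)))
                        , sym (trans (*-identityˡ _) (cong (λ t → c * σ x + d * t) (σ-f x))))
      = (λ Py≡0 → z≢0 (trans z≡ (y≡0⇒x*y≡0 Py≡0 λ′)))
      , z , z≢0 , trans (cong (_* P (σ x)) hz≡) (trans
          (solve 3 (λ l p q → (l :* q) :* p := q :* (l :* p)) refl λ′ (P (σ x)) (Q (σ x)))
          (cong (Q (σ x) *_) (sym z≡)))

    image⊇ : ∀ {x} → x ≢ 0# → ∃[ y ] (y ≢ 0# × h x * P y ≡ Q y * x)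
    image⊇ {x} x≢0 with (v₁ , v₂) , _ , (z , z≢0 , λ′ , _ , z≡ , fz≡) , μ , _ , x≡ , hx≡ ← Equivalence.to
        (image (x , h x) (x≢0 ∘ proj₁))
        (x , x≢0 , 1# , 0≢1 ∘ sym , sym (*-identityˡ _) , sym (*-identityˡ _)) =
      σ z , σ-nonzero z≢0 , (begin
        h x * P (σ z) ≡⟨ cong₂ _*_ hx≡ (scaled a b) ⟩
        μ * (c * σ v₁ + d * σ v₂) * (σ λ′ * (a * σ v₁ + b * σ v₂))
          ≡⟨ solve 4 (λ m p l q → m :* q :* (l :* p) := l :* q :* (m :* p)) refl μ (a * σ v₁ + b * σ v₂) (σ λ′)
              (c * σ v₁ + d * σ v₂) ⟩
        σ λ′ * (c * σ v₁ + d * σ v₂) * (μ * (a * σ v₁ + b * σ v₂)) ≡⟨ cong₂ _*_ (scaled c d) x≡ ⟨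
        Q (σ z) * x ∎)
      where
      -- The preimage v is only proportional to (z, f z), and σ turns the factor into `σ λ′`.
      -- Rebinding `a` and `b` lets one statement serve both rows of the matrix.
      scaled : ∀ a b → a * σ z + b * f′ (σ z) ≡ σ λ′ * (a * σ v₁ + b * σ v₂)
      scaled a b = begin
        a * σ z + b * f′ (σ z) ≡⟨ cong₂ (λ s t → a * s + b * t) (trans (cong σ z≡) (pres-* λ′ v₁))
                                   (trans (sym (σ-f z)) (trans (cong σ fz≡) (pres-* λ′ v₂))) ⟩
        a * (σ λ′ * σ v₁) + b * (σ λ′ * σ v₂)
          ≡⟨ solve 5 (λ a b l s t → a :* (l :* s) :+ b :* (l :* t) := l :* (a :* s :+ b :* t)) refl a b (σ λ′)
              (σ v₁) (σ v₂) ⟩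
        σ λ′ * (a * σ v₁ + b * σ v₂) ∎

-- From an equivalence to relations between coefficients

module Relations {N : ℕ} (F : FiniteField N) (q n : ℕ) .{{_ : NonZero n}}
  (N≡q^n : N ≡ q ℕ.^ n) (2<q : 2 < q) (^q-+ : PowerAdditive F q) where

  open FiniteField F
  open FieldTheory F
  open Sums F
  open QPolynomials F q n N≡q^n 2<q ^q-+
  open ≡-Reasoning

  module _ (b₁ b₂ : K) {e₁ e₂ : ℕ} (e₁<n : e₁ < n) (e₂<n : e₂ < n) (a b c d : K) where

    composite : (ℕ → K) → ℕ → K
    composite = comp-trinomial a (b * b₁) (b * b₂) (ℕ.<⇒≤ e₁<n) (ℕ.<⇒≤ e₂<n)

    numerator : ℕ → K
    numerator k = c * unit 0 k + binomial (d * b₁) e₁ (d * b₂) e₂ k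

    -- Everything that the two contradictions extract from an equivalence: G ∘ P = Q
    -- coefficientwise, and the invariants that G shares with `H`.
    record Parametrisation (H : ℕ → K) : Set where
      field
        G           : ℕ → K
        G-periodic  : Periodic G
        composite-G : ∀ {k} → k < n → composite G k ≡ numerator k
        G₀≡0        : G 0 ≡ 0#
        quadratic   : ∀ {k} → 0 < k → k < n → G k * χ k (G (n ∸ k)) ≡ H k * χ k (H (n ∸ k))

  module _ (γ : GammaL2) where
    open GammaL2 γ
    open FieldAut aut
    open Collineation F γ

    module _ (b₁ b₂ : K) {e₁ e₂ : ℕ} (e₁<n : e₁ < n) (e₂<n : e₂ < n) {f h : K → K}
      (σ-f : ∀ x → σ (f x) ≡ b₁ * χ e₁ (σ x) + b₂ * χ e₂ (σ x))
      {H : ℕ → K} (H-periodic : Periodic H) (h≡H : ∀ x → h x ≡ poly H x) (H₀≡0 : H 0 ≡ 0#)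
      (image : ImageEq γ (LinSet f) (LinSet h)) where

      private
        f′ P Q : K → K
        f′ y = b₁ * χ e₁ y + b₂ * χ e₂ y
        P y = a * y + b * f′ y
        Q y = c * y + d * f′ y

        T : K → K
        T = trinomial a (b * b₁) (b * b₂) (ℕ.<⇒≤ e₁<n) (ℕ.<⇒≤ e₂<n)

        numer : ℕ → K
        numer = numerator b₁ b₂ e₁<n e₂<n a b c d

        T≡P : ∀ y → T y ≡ P y
        T≡P y = solve 7 (λ a b b₁ b₂ y u v → a :* y :+ (b :* b₁ :* u :+ b :* b₂ :* v) :=
                    a :* y :+ b :* (b₁ :* u :+ b₂ :* v))
                  refl a b b₁ b₂ y (χ e₁ y) (χ e₂ y)

        numerator≡Q : ∀ y → poly numer y ≡ Q y
        numerator≡Q y = begin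
          poly numer y ≡⟨ poly-sum (λ k → c * unit 0 k) (binomial (d * b₁) e₁ (d * b₂) e₂) y ⟩
          poly (λ k → c * unit 0 k) y + poly (binomial (d * b₁) e₁ (d * b₂) e₂) y
            ≡⟨ cong₂ _+_ (trans (poly-unit c 0<n y) (cong (c *_) (χ-0 y)))
                (poly-binomial (d * b₁) (d * b₂) e₁<n e₂<n y) ⟩
          c * y + (d * b₁ * χ e₁ y + d * b₂ * χ e₂ y)
            ≡⟨ solve 7 (λ c d b₁ b₂ y u v → c :* y :+ (d :* b₁ :* u :+ d :* b₂ :* v) :=
                 c :* y :+ d :* (b₁ :* u :+ b₂ :* v))
                 refl c d b₁ b₂ y (χ e₁ y) (χ e₂ y) ⟩
          Q y ∎

        P-nonzero : ∀ y → y ≢ 0# → P y ≢ 0#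
        P-nonzero y y≢0 = proj₁ (image⊆ {f = f} {f′} {h} σ-f image y≢0)

        kernel : ∀ y → y ≢ 0# → T y ≢ 0#
        kernel y y≢0 Ty≡0 = P-nonzero y y≢0 (trans (sym (T≡P y)) Ty≡0)

        P-surjective : ∀ x → ∃[ y ] P y ≡ x
        P-surjective x =
          let y , eq = trinomial-surjective a (b * b₁) (b * b₂) (ℕ.<⇒≤ e₁<n) (ℕ.<⇒≤ e₂<n) kernel x
          in y , trans (sym (T≡P y)) eq

        P-0 : P 0# ≡ 0#
        P-0 = trans (sym (T≡P 0#)) (additive-0 (trinomial-+ a (b * b₁) (b * b₂) (ℕ.<⇒≤ e₁<n) (ℕ.<⇒≤ e₂<n)))

        swap-right : ∀ x y z → x * y * z ≡ x * z * y
        swap-right = solve 3 (λ x y z → x :* y :* z := x :* z :* y) refl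

        module _ {G : ℕ → K} (G∘P≡Q : ∀ y → poly G (P y) ≡ Q y) where

          -- A nonzero x is P y for some nonzero y, so the slope of G at x is Q y / P y, which
          -- `image⊆` finds among the slopes of h.
          slopes⊆ : ∀ m → Slope (poly G) m → Slope (poly H) m
          slopes⊆ m (x , x≢0 , Gx≡mx) =
            let y , Py≡x = P-surjective x
                Py≢0 = λ Py≡0 → x≢0 (trans (sym Py≡x) Py≡0)
                z , z≢0 , hzPy≡Qyz = proj₂ (image⊆ {f = f} {f′} {h} σ-f image (λ y≡0 → Py≢0 (trans (cong P y≡0) P-0)))
            in z , z≢0 , *-cancelʳ Py≢0 (begin
              poly H z * P y ≡⟨ cong (_* P y) (h≡H z) ⟨
              h z * P y      ≡⟨ hzPy≡Qyz ⟩
              Q y * z        ≡⟨ cong (_* z) (trans (sym (G∘P≡Q y))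
                  (subst (λ x → poly G x ≡ m * x) (sym Py≡x) Gx≡mx)) ⟩
              m * P y * z    ≡⟨ swap-right m (P y) z ⟩
              m * z * P y    ∎)

          slopes⊇ : ∀ m → Slope (poly H) m → Slope (poly G) m
          slopes⊇ m (x , x≢0 , Hx≡mx) =
            let y , y≢0 , hxPy≡Qyx = image⊇ {f = f} {f′} {h} σ-f image x≢0
            in P y , P-nonzero y y≢0 , *-cancelʳ x≢0 (begin
              poly G (P y) * x ≡⟨ cong (_* x) (G∘P≡Q y) ⟩
              Q y * x          ≡⟨ hxPy≡Qyx ⟨
              h x * P y        ≡⟨ cong (_* P y) (trans (h≡H x) Hx≡mx) ⟩
              m * x * P y      ≡⟨ swap-right m x (P y) ⟩
              m * P y * x      ∎)

        module _ {G : ℕ → K} (G-periodic : Periodic G)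
          (composite-G : ∀ {k} → k < n → composite b₁ b₂ e₁<n e₂<n a b c d G k ≡ numer k)
          (G∘T≡numer : ∀ x → poly G (T x) ≡ poly numer x) where

          G∘P≡Q : ∀ y → poly G (P y) ≡ Q y
          G∘P≡Q y = trans (cong (poly G) (sym (T≡P y))) (trans (G∘T≡numer y) (numerator≡Q y))

          coefficient₀ : G 0 ≡ 0#
          coefficient₀ = trans (slopes⇒coefficient₀ {G} {H} G-periodic H-periodic (slopes⊆ {G} G∘P≡Q)
              (slopes⊇ {G} G∘P≡Q)) H₀≡0

          fromComposite : Parametrisation b₁ b₂ e₁<n e₂<n a b c d H
          fromComposite = record
            { G           = G
            ; G-periodic  = G-periodic
            ; composite-G = composite-G
            ; G₀≡0        = coefficient₀
            ; quadratic   = slopes⇒quadratic {G} {H} G-periodic H-periodic (slopes⊆ {G} G∘P≡Q)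
                (slopes⊇ {G} G∘P≡Q) coefficient₀
            }

      parametrisation : Parametrisation b₁ b₂ e₁<n e₂<n a b c d H
      parametrisation =
        let G , G-periodic , composite-G , G∘T≡numer =
              comp-trinomial-surjective a (b * b₁) (b * b₂) (ℕ.<⇒≤ e₁<n) (ℕ.<⇒≤ e₂<n) kernel numer
        in fromComposite {G} G-periodic composite-G G∘T≡numer

  -- Recurrences and the two contradictions

  f2≡poly : ∀ {s} δ → s < n → n ∸ s < n → ∀ x → f2 q n s δ x ≡ poly (binomial δ s 1# (n ∸ s)) x
  f2≡poly {s} δ s<n n∸s<n x = trans (cong (δ * χ s x +_) (sym (*-identityˡ _))) (sym (poly-binomial δ 1# s<n n∸s<n x))

  first-zero : ∀ {x y z} → x + (y + z) ≡ 0# → y ≡ 0# → z ≡ 0# → x ≡ 0#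
  first-zero eq refl refl = trans (sym (trans (cong (_ +_) (+-identityʳ 0#)) (+-identityʳ _))) eq

  second-zero : ∀ {x y z} → x + (y + z) ≡ 0# → x ≡ 0# → z ≡ 0# → y ≡ 0#
  second-zero eq refl refl = trans (sym (trans (+-identityˡ _) (+-identityʳ _))) eq

  third-zero : ∀ {x y z} → x + (y + z) ≡ 0# → x ≡ 0# → y ≡ 0# → z ≡ 0#
  third-zero eq refl refl = trans (sym (trans (+-identityˡ _) (+-identityˡ _))) eq

  left-factor-zero : ∀ {x y} → x * y ≡ 0# → y ≢ 0# → x ≡ 0#
  left-factor-zero xy≡0 y≢0 = [ id , (λ y≡0 → contradiction y≡0 y≢0) ]′ (zero-product xy≡0)

  right-factor-zero : ∀ {x y} → x * y ≡ 0# → x ≢ 0# → y ≡ 0#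
  right-factor-zero xy≡0 x≢0 = [ (λ x≡0 → contradiction x≡0 x≢0) , id ]′ (zero-product xy≡0)

  χ-reflects-zero : ∀ i {x} → χ i x ≡ 0# → x ≡ 0#
  χ-reflects-zero i {x} χ≡0 with x ≟ 0#
  ... | yes x≡0 = x≡0
  ... | no  x≢0 = contradiction χ≡0 (χ-nonzero i x≢0)

  -- If neither a nor b vanishes then G is nonzero on all of {1, …, n−1} or on none of it; otherwise it
  -- is supported on one end of that interval.
  recurrence-contradiction : ∀ {a b} {G : ℕ → K} → (a ≡ 0# → b ≢ 0#) →
    (∀ {j} → 0 < j → suc j < n → G (suc j) * χ (suc j) a + G j * χ j b ≡ 0#) →
    ∀ {s t} → 0 < s → s < n → 0 < t → t < n → s ≢ t → G s ≢ 0# → G t ≢ 0# →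
    ∀ {k} → 0 < k → k < n → G k ≡ 0# → ⊥
  recurrence-contradiction {a} {b} {G} a≡0⇒b≢0 rec {s} {t} 0<s s<n 0<t t<n s≢t Gs≢0 Gt≢0 {k} 0<k k<n Gk≡0 =
    case a ≟ 0# of λ where
      (yes a≡0) → not-low (λ {j} 0<j 1+j<n → down (a≡0⇒b≢0 a≡0) 0<j 1+j<n (y≡0⇒x*y≡0 (χ-≡0 a≡0 (suc j)) _))
      (no a≢0) → case b ≟ 0# of λ where
        (yes b≡0) → not-high (λ {j} 0<j 1+j<n → up a≢0 0<j 1+j<n (y≡0⇒x*y≡0 (χ-≡0 b≡0 j) _))
        (no b≢0) → Gs≢0 (climb a≢0 0<s s<n (descend b≢0 0<k k<n Gk≡0))
    where
    χ-≡0 : ∀ {x} → x ≡ 0# → ∀ i → χ i x ≡ 0#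
    χ-≡0 refl i = χ-zero i
    down : b ≢ 0# → ∀ {j} → 0 < j → suc j < n → G (suc j) * χ (suc j) a ≡ 0# → G j ≡ 0#
    down b≢0 {j} 0<j 1+j<n eq = left-factor-zero
      (trans (sym (trans (cong (_+ G j * χ j b) eq) (+-identityˡ _))) (rec 0<j 1+j<n)) (χ-nonzero j b≢0)
    up : a ≢ 0# → ∀ {j} → 0 < j → suc j < n → G j * χ j b ≡ 0# → G (suc j) ≡ 0#
    up a≢0 {j} 0<j 1+j<n eq = left-factor-zero
      (trans (sym (trans (cong (G (suc j) * χ (suc j) a +_) eq) (+-identityʳ _))) (rec 0<j 1+j<n))
          (χ-nonzero (suc j) a≢0)
    descend : b ≢ 0# → ∀ {j} → 0 < j → j < n → G j ≡ 0# → G 1 ≡ 0#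
    descend b≢0 {suc zero}      0<j j<n eq = eq
    descend b≢0 {suc j@(suc _)} 0<j j<n eq =
      descend b≢0 {j} (s≤s z≤n) (ℕ.<-trans (ℕ.n<1+n j) j<n) (down b≢0 (s≤s z≤n) j<n (x≡0⇒x*y≡0 eq _))
    climb : a ≢ 0# → ∀ {j} → 0 < j → j < n → G 1 ≡ 0# → G j ≡ 0#
    climb a≢0 {suc zero}      0<j j<n eq = eq
    climb a≢0 {suc j@(suc _)} 0<j j<n eq =
      up a≢0 (s≤s z≤n) j<n (x≡0⇒x*y≡0 (climb a≢0 {j} (s≤s z≤n) (ℕ.<-trans (ℕ.n<1+n j) j<n) eq) _)
    not-low : (∀ {j} → 0 < j → suc j < n → G j ≡ 0#) → ⊥
    not-low low with suc s ℕ.<? n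
    ... | yes 1+s<n = Gs≢0 (low 0<s 1+s<n)
    ... | no  1+s≮n = Gt≢0 (low 0<t (ℕ.≤∧≢⇒< t<n
      (λ 1+t≡n → s≢t (ℕ.suc-injective (trans (ℕ.≤-antisym s<n (ℕ.≮⇒≥ 1+s≮n)) (sym 1+t≡n))))))
    high-at : (∀ {j} → 0 < j → suc j < n → G (suc j) ≡ 0#) → ∀ {i} → 0 < i → i < n → i ≢ 1 → G i ≡ 0#
    high-at high {suc zero}    0<i i<n i≢1 = contradiction refl i≢1
    high-at high {suc (suc i)} 0<i i<n i≢1 = high (s≤s z≤n) i<n
    not-high : (∀ {j} → 0 < j → suc j < n → G (suc j) ≡ 0#) → ⊥
    not-high high with s ℕ.≟ 1
    ... | yes refl = Gt≢0 (high-at high 0<t t<n (s≢t ∘ sym))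
    ... | no  s≢1  = Gs≢0 (high-at high 0<s s<n s≢1)

  -- For exponents 1 and n - 1, the coefficient at j + 1 receives G at j from X^q, and G at j + 2
  -- from X^(q^(n-1)), since -(n - 1) is 1 modulo n.
  composite-suc : ∀ b₁ b₂ (1<n : 1 < n) (n∸1<n : n ∸ 1 < n) a b c d {G} → Periodic G → ∀ j →
    composite b₁ b₂ 1<n n∸1<n a b c d G (suc j) ≡
    G (suc j) * χ (suc j) a + (G j * χ j (b * b₁) + G (suc (suc j)) * χ (suc (suc j)) (b * b₂))
  composite-suc b₁ b₂ 1<n n∸1<n a b c d {G} per j = cong (G (suc j) * χ (suc j) a +_) (cong₂ _+_
    (trans (cong (comp-monomial G (b * b₁) 1) (ℕ.+-comm 1 j)) (comp-monomial-shift per (b * b₁) (ℕ.<⇒≤ 1<n) j))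
    (cong (λ k → G k * χ k (b * b₂))
      (trans (cong (suc j ℕ.+_) (ℕ.m∸[m∸n]≡n (ℕ.<⇒≤ 1<n))) (ℕ.+-comm (suc j) 1))))

  numerator-other : ∀ {b₁ b₂ e₁ e₂} (e₁<n : e₁ < n) (e₂<n : e₂ < n) a b c d {k} → k < n → k ≢ 0 → k ≢ e₁ → k ≢ e₂ →
    numerator b₁ b₂ e₁<n e₂<n a b c d k ≡ 0#
  numerator-other _ _ a b c d k<n k≢0 k≢e₁ k≢e₂ = trans
    (cong₂ _+_ (y≡0⇒x*y≡0 (unit-≢ k<n k≢0) c) (binomial-other _ _ k<n k≢e₁ k≢e₂)) (+-identityʳ 0#)

  n∸s<n : ∀ {s} → 0 < s → s < n → n ∸ s < n
  n∸s<n 0<s s<n = ℕ.∸-monoʳ-< 0<s (ℕ.<⇒≤ s<n)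

  module _ (4≤n : 4 ≤ n) where

    private
      1<n : 1 < n
      1<n = ℕ.≤-trans (s≤s (s≤s z≤n)) 4≤n

    -- {1, ..., n-1} has at least three elements, at most two of them excluded: 1 serves unless it
    -- is s or n - s, and then 2 does, as n is not 3.
    other-index : ∀ {s} → s < n → ∃[ k ] (0 < k × k < n × k ≢ s × k ≢ n ∸ s)
    other-index {s} s<n with s ℕ.≟ 1 | n ∸ s ℕ.≟ 1
    ... | no s≢1 | no n∸s≢1 = 1 , s≤s z≤n , 1<n , s≢1 ∘ sym , n∸s≢1 ∘ sym
    ... | yes refl | _ = 2 , s≤s z≤n , ℕ.≤-trans (s≤s (s≤s (s≤s z≤n))) 4≤n , (λ ()) ,
      λ 2≡n∸1 → ℕ.<⇒≢ 4≤n (trans (cong suc 2≡n∸1) (ℕ.m+[n∸m]≡n (ℕ.<⇒≤ 1<n)))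
    ... | no _ | yes n∸s≡1 = 2 , s≤s z≤n , ℕ.≤-trans (s≤s (s≤s (s≤s z≤n))) 4≤n ,
      (λ { refl → ℕ.<⇒≢ 4≤n (trans (cong (2 ℕ.+_) (sym n∸s≡1)) (ℕ.m+[n∸m]≡n (ℕ.<⇒≤ s<n))) }) ,
      λ 2≡n∸s → case trans 2≡n∸s n∸s≡1 of λ ()

    -- The product of G at the pair {s, n-s} is δ, so both entries are nonzero. At an index outside
    -- the pair the product is 0, so G also has a zero, which the two-term recurrence coming from
    -- x^q forbids.
    ¬pseudoregulus : ∀ {s δ} → 0 < s → s < n → s ≢ n ∸ s → δ ≢ 0# → ¬ PseudoregulusType q (L2 q n s δ)
    ¬pseudoregulus {s} {δ} 0<s s<n s≢n∸s δ≢0 (γ , image) =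
      let k , 0<k , k<n , k≢s , k≢n∸s = other-index s<n
          contra = recurrence-contradiction {a} {b} {G} a≡0⇒b≢0 recurrence 0<s s<n 0<n∸s (n∸s<n 0<s s<n) s≢n∸s
              Gs≢0 Gn∸s≢0
      in case zero-product (trans (quadratic 0<k k<n) (x≡0⇒x*y≡0 (binomial-other δ 1# k<n k≢s k≢n∸s) _)) of λ where
        (inj₁ Gk≡0)  → contra 0<k k<n Gk≡0
        (inj₂ χGn∸k≡0) → contra (ℕ.m<n⇒0<n∸m k<n) (n∸s<n 0<k k<n) (χ-reflects-zero k χGn∸k≡0)
      where
      open GammaL2 γ
      open FieldAut aut
      open Collineation F γ
      0<n∸s : 0 < n ∸ s
      0<n∸s = ℕ.m<n⇒0<n∸m s<n
      H : ℕ → K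
      H = binomial δ s 1# (n ∸ s)
      n∸1<n : n ∸ 1 < n
      n∸1<n = n∸s<n (s≤s z≤n) 1<n
      -- x^q is written with a second term of coefficient 0, to fit the two-term shape of
      -- `parametrisation`.
      σ-^q : ∀ x → σ (x ^ q) ≡ 1# * χ 1 (σ x) + 0# * χ (n ∸ 1) (σ x)
      σ-^q x = trans (σ-^ x q) (sym (trans (cong₂ _+_ (*-identityˡ _) (zeroˡ _))
        (trans (+-identityʳ _) (cong (σ x ^_) (ℕ.*-identityʳ q)))))
      open Parametrisation (parametrisation γ 1# 0# 1<n n∸1<n {λ x → x ^ q} {f2 q n s δ} σ-^q {H}
        (binomial-periodic δ s 1# (n ∸ s)) (f2≡poly δ s<n (n∸s<n 0<s s<n))
        (binomial-other δ 1# 0<n (ℕ.<⇒≢ 0<s) (ℕ.<⇒≢ 0<n∸s)) image)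
      a≡0⇒b≢0 : a ≡ 0# → b ≢ 0#
      a≡0⇒b≢0 a≡0 b≡0 = ¬singular (x≡0⇒x*y≡0 a≡0 d) (x≡0⇒x*y≡0 b≡0 c)
      recurrence : ∀ {j} → 0 < j → suc j < n → G (suc j) * χ (suc j) a + G j * χ j b ≡ 0#
      recurrence {j} 0<j 1+j<n = begin
        G (suc j) * χ (suc j) a + G j * χ j b
          ≡⟨ cong (G (suc j) * χ (suc j) a +_) (sym (trans (cong₂ _+_ (cong (λ b → G j * χ j b) (*-identityʳ b))
               (y≡0⇒x*y≡0 (trans (cong (χ (suc (suc j))) (zeroʳ b)) (χ-zero (suc (suc j)))) _)) (+-identityʳ _))) ⟩
        G (suc j) * χ (suc j) a + (G j * χ j (b * 1#) + G (suc (suc j)) * χ (suc (suc j)) (b * 0#))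
          ≡⟨ composite-suc 1# 0# 1<n n∸1<n a b c d G-periodic j ⟨
        composite 1# 0# 1<n n∸1<n a b c d G (suc j) ≡⟨ composite-G 1+j<n ⟩
        c * unit 0 (suc j) + (d * 1# * unit 1 (suc j) + d * 0# * unit (n ∸ 1) (suc j))
          ≡⟨ cong₂ _+_ (y≡0⇒x*y≡0 (unit-≢ 1+j<n (λ ())) c) (cong₂ _+_
               (y≡0⇒x*y≡0 (unit-≢ 1+j<n (ℕ.>⇒≢ (s≤s 0<j))) _) (x≡0⇒x*y≡0 (zeroʳ d) _)) ⟩
        0# + (0# + 0#) ≡⟨ trans (+-identityˡ _) (+-identityˡ _) ⟩
        0# ∎
      quadratic-s : G s * χ s (G (n ∸ s)) ≢ 0#
      quadratic-s eq = *-nonzero δ≢0 (0≢1 ∘ sym) (trans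
        (sym (cong₂ _*_ (binomial-first δ 1# s<n s≢n∸s)
                        (trans (cong (χ s) (binomial-second δ 1# (n∸s<n 0<s s<n) (s≢n∸s ∘ sym))) (χ-one s))))
        (trans (sym (quadratic 0<s s<n)) eq))
      Gs≢0 : G s ≢ 0#
      Gs≢0 Gs≡0 = quadratic-s (x≡0⇒x*y≡0 Gs≡0 _)
      Gn∸s≢0 : G (n ∸ s) ≢ 0#
      Gn∸s≢0 eq = quadratic-s (y≡0⇒x*y≡0 (trans (cong (χ s) eq) (χ-zero s)) _)

  module _ (n≡8 : n ≡ 8) where

    private
      <n : ∀ {k} → k < 8 → k < n
      <n = subst (_ <_) (sym n≡8)

      n∸≡ : ∀ k → n ∸ k ≡ 8 ∸ k
      n∸≡ k = cong (_∸ k) n≡8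

      ≢∸ : ∀ {i} k → i ≢ 8 ∸ k → i ≢ n ∸ k
      ≢∸ k i≢ i≡ = i≢ (trans i≡ (n∸≡ k))

      1<n : 1 < n
      1<n = <n (from-yes (1 ℕ.<? 8))

      3<n : 3 < n
      3<n = <n (from-yes (3 ℕ.<? 8))

      7<n : 7 < n
      7<n = <n (from-yes (7 ℕ.<? 8))

      n∸1<n : n ∸ 1 < n
      n∸1<n = n∸s<n (s≤s z≤n) 1<n

      n∸3<n : n ∸ 3 < n
      n∸3<n = n∸s<n (s≤s z≤n) 3<n

    -- The invariants of h make G nonzero at 3 and 5, zero at 4, and zero at one of 1, 7 and at one
    -- of 2, 6. Whether or not b vanishes, the relations force G to be nonzero at both 1 and 7.
    ¬equivalent : ∀ {δ ρ} → δ ≢ 0# → ρ ≢ 0# → ¬ PΓLEquivalent (L2 q n 1 δ) (L2 q n 3 ρ)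
    ¬equivalent {δ} {ρ} δ≢0 ρ≢0 (γ , image) = case b ≟ 0# of λ where
        (yes b≡0) → b≡0-contradiction b≡0
        (no  b≢0) → b≢0-contradiction b≢0
      where
      open GammaL2 γ
      open FieldAut aut
      open Collineation F γ
      H : ℕ → K
      H = binomial ρ 3 1# (n ∸ 3)
      σ-f : ∀ x → σ (f2 q n 1 δ x) ≡ σ δ * χ 1 (σ x) + 1# * χ (n ∸ 1) (σ x)
      σ-f x = trans (pres-+ _ _) (cong₂ _+_ (trans (pres-* _ _) (cong (σ δ *_) (σ-^ x (q ℕ.^ 1))))
        (trans (σ-^ x (q ℕ.^ (n ∸ 1))) (sym (*-identityˡ _))))
      open Parametrisation (parametrisation γ (σ δ) 1# 1<n n∸1<n {f2 q n 1 δ} {f2 q n 3 ρ} σ-f {H}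
        (binomial-periodic ρ 3 1# (n ∸ 3)) (f2≡poly ρ 3<n n∸3<n)
        (binomial-other ρ 1# 0<n (λ ()) (≢∸ 3 (λ ()))) image)

      relation : ∀ j → suc j < n →
        G (suc j) * χ (suc j) a + (G j * χ j (b * σ δ) + G (suc (suc j)) * χ (suc (suc j)) (b * 1#)) ≡
        numerator (σ δ) 1# 1<n n∸1<n a b c d (suc j)
      relation j 1+j<n = trans (sym (composite-suc (σ δ) 1# 1<n n∸1<n a b c d G-periodic j)) (composite-G 1+j<n)

      interior : ∀ {j} → 0 < j → suc (suc j) < n →
        G (suc j) * χ (suc j) a + (G j * χ j (b * σ δ) + G (suc (suc j)) * χ (suc (suc j)) (b * 1#)) ≡ 0#
      interior {j} 0<j 2+j<n = trans (relation j 1+j<n)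
        (numerator-other 1<n n∸1<n a b c d 1+j<n (λ ()) (ℕ.>⇒≢ (s≤s 0<j))
          (λ 1+j≡n∸1 → ℕ.<⇒≢ 2+j<n (trans (cong suc 1+j≡n∸1) (ℕ.m+[n∸m]≡n (ℕ.<⇒≤ 1<n)))))
        where
        1+j<n : suc j < n
        1+j<n = ℕ.<-trans (ℕ.n<1+n _) 2+j<n

      vanishing : ∀ k → 0 < k → k < n → k ≢ 3 → k ≢ 5 → G k ≡ 0# ⊎ G (8 ∸ k) ≡ 0#
      vanishing k 0<k k<n k≢3 k≢5 = [ inj₁ , inj₂ ∘ trans (cong G (sym (n∸≡ k))) ∘ χ-reflects-zero k ]′ (zero-product
        (trans (quadratic 0<k k<n) (x≡0⇒x*y≡0 (binomial-other ρ 1# k<n k≢3 (≢∸ 3 k≢5)) _)))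

      G₁≡0⊎G₇≡0 : G 1 ≡ 0# ⊎ G 7 ≡ 0#
      G₁≡0⊎G₇≡0 = vanishing 1 (s≤s z≤n) 1<n (λ ()) (λ ())

      G₂≡0⊎G₆≡0 : G 2 ≡ 0# ⊎ G 6 ≡ 0#
      G₂≡0⊎G₆≡0 = vanishing 2 (s≤s z≤n) (<n (from-yes (2 ℕ.<? 8))) (λ ()) (λ ())

      -- 4 is its own partner in 4 + 4 = 8, so both alternatives are the same equation.
      G₄≡0 : G 4 ≡ 0#
      G₄≡0 = [ id , id ]′ (vanishing 4 (s≤s z≤n) (<n (from-yes (4 ℕ.<? 8))) (λ ()) (λ ()))

      quadratic₃ : G 3 * χ 3 (G 5) ≢ 0#
      quadratic₃ eq = *-nonzero ρ≢0 (0≢1 ∘ sym) (trans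
        (sym (cong₂ _*_ (binomial-first ρ 1# 3<n (≢∸ 3 (λ ())))
                        (trans (cong (χ 3) (binomial-second ρ 1# n∸3<n (≢∸ 3 (λ ()) ∘ sym))) (χ-one 3))))
        (trans (sym (quadratic (s≤s z≤n) 3<n)) (trans (cong (λ k → G 3 * χ 3 (G k)) (n∸≡ 3)) eq)))

      G₃≢0 : G 3 ≢ 0#
      G₃≢0 eq = quadratic₃ (x≡0⇒x*y≡0 eq _)

      G₅≢0 : G 5 ≢ 0#
      G₅≢0 eq = quadratic₃ (y≡0⇒x*y≡0 (trans (cong (χ 3) eq) (χ-zero 3)) _)

      σδ≢0 : σ δ ≢ 0#
      σδ≢0 = σ-nonzero δ≢0

      module _ (b≢0 : b ≢ 0#) where
        χ[bσδ]≢0 : ∀ i → χ i (b * σ δ) ≢ 0#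
        χ[bσδ]≢0 i = χ-nonzero i (*-nonzero b≢0 σδ≢0)

        χ[b]≢0 : ∀ i → χ i (b * 1#) ≢ 0#
        χ[b]≢0 i = χ-nonzero i (*-nonzero b≢0 (0≢1 ∘ sym))

        relation₂ = interior {1} (s≤s z≤n) (<n (from-yes (3 ℕ.<? 8)))
        relation₃ = interior {2} (s≤s z≤n) (<n (from-yes (4 ℕ.<? 8)))
        relation₅ = interior {4} (s≤s z≤n) (<n (from-yes (6 ℕ.<? 8)))
        relation₆ = interior {5} (s≤s z≤n) (<n (from-yes (7 ℕ.<? 8)))

        -- The zero at 4 together with the one at 2 or 6 leaves a single term, a multiple of a power
        -- of a, in the relation at 3 or at 5. With a gone, the relations at 2 and 6 tie G₁ to G₃
        -- and G₅ to G₇.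
        a≡0 : a ≡ 0#
        a≡0 = case G₂≡0⊎G₆≡0 of λ where
          (inj₁ G₂≡0) → χ-reflects-zero 3 (right-factor-zero
            (first-zero relation₃ (x≡0⇒x*y≡0 G₂≡0 _) (x≡0⇒x*y≡0 G₄≡0 _)) G₃≢0)
          (inj₂ G₆≡0) → χ-reflects-zero 5 (right-factor-zero
            (first-zero relation₅ (x≡0⇒x*y≡0 G₄≡0 _) (x≡0⇒x*y≡0 G₆≡0 _)) G₅≢0)

        χ[a]≡0 : ∀ i → χ i a ≡ 0#
        χ[a]≡0 i = trans (cong (χ i) a≡0) (χ-zero i)

        G₁≢0 : G 1 ≢ 0#
        G₁≢0 G₁≡0 = G₃≢0 (left-factor-zero
          (third-zero relation₂ (y≡0⇒x*y≡0 (χ[a]≡0 2) _) (x≡0⇒x*y≡0 G₁≡0 _)) (χ[b]≢0 3))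

        G₇≢0 : G 7 ≢ 0#
        G₇≢0 G₇≡0 = G₅≢0 (left-factor-zero
          (second-zero relation₆ (y≡0⇒x*y≡0 (χ[a]≡0 6) _) (x≡0⇒x*y≡0 G₇≡0 _)) (χ[bσδ]≢0 5))

        b≢0-contradiction : ⊥
        b≢0-contradiction = [ G₁≢0 , G₇≢0 ]′ G₁≡0⊎G₇≡0

      -- Now composition only rescales G, so a zero of G at 1 or 7 is a zero of the numerator; but
      -- there the numerator has the values d σ(δ) and d.
      module _ (b≡0 : b ≡ 0#) where
        d≢0 : d ≢ 0#
        d≢0 d≡0 = ¬singular (y≡0⇒x*y≡0 d≡0 a) (x≡0⇒x*y≡0 b≡0 c)

        numerator≡0 : ∀ {j} → suc j < n → G (suc j) ≡ 0# → numerator (σ δ) 1# 1<n n∸1<n a b c d (suc j) ≡ 0#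
        numerator≡0 {j} 1+j<n G≡0 = trans (sym (relation j 1+j<n)) (trans
          (cong₂ _+_ (x≡0⇒x*y≡0 G≡0 _) (cong₂ _+_ (b-term j (σ δ)) (b-term (suc (suc j)) 1#)))
          (trans (+-identityˡ _) (+-identityˡ _)))
          where
          b-term : ∀ i x → G i * χ i (b * x) ≡ 0#
          b-term i x = y≡0⇒x*y≡0 (trans (cong (χ i) (x≡0⇒x*y≡0 b≡0 x)) (χ-zero i)) (G i)

        numerator-end : ∀ {k β} → k < n → k ≢ 0 → binomial (d * σ δ) 1 (d * 1#) (n ∸ 1) k ≡ β →
          numerator (σ δ) 1# 1<n n∸1<n a b c d k ≡ β
        numerator-end k<n k≢0 eq = trans (cong₂ _+_ (y≡0⇒x*y≡0 (unit-≢ k<n k≢0) c) eq) (+-identityˡ _)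

        b≡0-contradiction : ⊥
        b≡0-contradiction = case G₁≡0⊎G₇≡0 of λ where
          (inj₁ G₁≡0) → *-nonzero d≢0 σδ≢0 (trans
            (sym (numerator-end 1<n (λ ()) (binomial-first (d * σ δ) (d * 1#) 1<n (≢∸ 1 (λ ())))))
            (numerator≡0 1<n G₁≡0))
          (inj₂ G₇≡0) → *-nonzero d≢0 (0≢1 ∘ sym) (trans
            (sym (numerator-end 7<n (λ ()) (trans
              (cong (binomial (d * σ δ) 1 (d * 1#) (n ∸ 1)) (sym (n∸≡ 1)))
              (binomial-second (d * σ δ) (d * 1#) n∸1<n (≢∸ 1 (λ ()) ∘ sym)))))
            (numerator≡0 7<n G₇≡0))

-- Numerical conditions and conclusion

-- Otherwise n = 2s, so s divides gcd(s, n) = 1 and n = 2.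
s≢n∸s : ∀ {s n} → 4 ≤ n → s < n → gcd s n ≡ 1 → s ≢ n ∸ s
s≢n∸s {s} {n} 4≤n s<n gcd≡1 s≡n∸s = ℕ.<⇒≱ (s≤s (s≤s (s≤s z≤n))) (subst (4 ≤_) n≡2 4≤n)
  where
  n≡s+s : n ≡ s ℕ.+ s
  n≡s+s = trans (sym (ℕ.m+[n∸m]≡n (ℕ.<⇒≤ s<n))) (cong (s ℕ.+_) (sym s≡n∸s))
  s≡1 : s ≡ 1
  s≡1 = ∣1⇒≡1 (subst (s ∣_) gcd≡1 (gcd-greatest ∣-refl (subst (s ∣_) (sym n≡s+s) (∣m∣n⇒∣m+n ∣-refl ∣-refl))))
  n≡2 : n ≡ 2
  n≡2 = trans n≡s+s (cong (λ s → s ℕ.+ s) s≡1)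

-- The geometric sum for q = 2. It turns δ times its norm into δ^(2^n), which is δ.
normExp-2 : ∀ n → suc (normExp 2 n) ≡ 2 ℕ.^ n
normExp-2 zero    = refl
normExp-2 (suc n) = trans (sym (ℕ.+-suc (2 ℕ.^ n) _))
  (cong (2 ℕ.^ n ℕ.+_) (trans (normExp-2 n) (sym (ℕ.+-identityʳ (2 ℕ.^ n)))))

normExp>0 : ∀ {q} → 0 < q → ∀ {n} → 0 < n → 0 < normExp q n
normExp>0 {q@(suc _)} 0<q {suc n} _ = ℕ.<-≤-trans (ℕ.m^n>0 q n) (ℕ.m≤m+n _ _)

primePower>1 : ∀ {q} → IsPrimePower q → 1 < q
primePower>1 (p , k , pr , refl) = ℕ.<-≤-trans (ℕ.nonTrivial⇒n>1 p {{prime⇒nonTrivial pr}})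
  (subst (_≤ p ℕ.* p ℕ.^ k) (ℕ.*-identityʳ p) (ℕ.*-monoʳ-≤ p (ℕ.m^n>0 p {{prime⇒nonZero pr}} k)))

^q-additive : ∀ {q} n → IsPrimePower q → (F : FiniteField (q ℕ.^ n)) → PowerAdditive F q
^q-additive n (p , k , pr , refl) F = Sums.^p^-+ F {p} {suc k ℕ.* n} pr (ℕ.^-*-assoc p (suc k) n) (suc k)

module _ {q : ℕ} (n : ℕ) (q-pp : IsPrimePower q) (0<n : 0 < n) (F : FiniteField (q ℕ.^ n))
  (δ : FiniteField.K F) (Norm≢0 : FiniteField.Norm F q n δ ≢ FiniteField.0# F) where

  open FiniteField F
  open FieldTheory F

  norm-nonzero : δ ≢ 0#
  norm-nonzero refl = Norm≢0 (0^ (normExp>0 (ℕ.<-trans (s≤s z≤n) (primePower>1 q-pp)) 0<n))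

  -- Over 𝔽₂ the norm takes only the values 0 and 1.
  norm-proper⇒2<q : Norm q n δ ≢ 1# → 2 < q
  norm-proper⇒2<q Norm≢1 = ℕ.≤∧≢⇒< (primePower>1 q-pp) λ { refl → Norm≢1 (*-cancelˡ norm-nonzero
    (trans (cong (δ ^_) (normExp-2 n)) (trans (fermat (ℕ.m^n>0 2 n) δ) (sym (*-identityʳ δ))))) }

open import Data.Nat using (_^_)

theorem3p4 : ((q n s : ℕ) → IsPrimePower q → 4 ≤ n → 1 ≤ s → s ≤ n ∸ 1 → gcd s n ≡ 1 →
    (F : FiniteField (q ^ n)) → (δ : FiniteField.K F) →
    FiniteField.Norm F q n δ ≢ FiniteField.0# F →
    FiniteField.Norm F q n δ ≢ FiniteField.1# F →
    ¬ FiniteField.PseudoregulusType F q (FiniteField.L2 F q n s δ))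
    ×
    ((q : ℕ) → IsPrimePower q →
    (F : FiniteField (q ^ 8)) → (δ ρ : FiniteField.K F) →
    FiniteField.Norm F q 8 δ ≢ FiniteField.0# F →
    FiniteField.Norm F q 8 δ ≢ FiniteField.1# F →
    FiniteField.Norm F q 8 ρ ≢ FiniteField.0# F →
    FiniteField.Norm F q 8 ρ ≢ FiniteField.1# F →
    ¬ FiniteField.PΓLEquivalent F (FiniteField.L2 F q 8 1 δ) (FiniteField.L2 F q 8 3 ρ))
theorem3p4 =
  (λ where
    -- Matching n as a successor supplies `NonZero n` and lets `s≤s` turn the bound s ≤ n - 1 into s
    -- < n.
    q n@(suc _) s q-pp 4≤n 1≤s s≤n∸1 gcd≡1 F δ Norm≢0 Norm≢1 →
      Relations.¬pseudoregulus F q n refl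
        (norm-proper⇒2<q n q-pp (s≤s z≤n) F δ Norm≢0 Norm≢1) (^q-additive n q-pp F)
        4≤n 1≤s (s≤s s≤n∸1) (s≢n∸s 4≤n (s≤s s≤n∸1) gcd≡1) (norm-nonzero n q-pp (s≤s z≤n) F δ Norm≢0)) ,
  λ q q-pp F δ ρ Normδ≢0 Normδ≢1 Normρ≢0 _ →
    Relations.¬equivalent F q 8 refl
      (norm-proper⇒2<q 8 q-pp (s≤s z≤n) F δ Normδ≢0 Normδ≢1) (^q-additive 8 q-pp F)
      refl (norm-nonzero 8 q-pp (s≤s z≤n) F δ Normδ≢0) (norm-nonzero 8 q-pp (s≤s z≤n) F ρ Normρ≢0)
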